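{- Let $q$ be a prime power, $D\ge3$, and $e\in\{0,1,2\}$ or $e\in\{1/2,3/2\}$ with $q$ a square. With $\ell_i^\pm$ ($-1\le i\le D$) as in the context, for every $0\le i\le D-1$ the following identities hold in $\mathbb C[\eta,\eta^{ -1}]$: $$\eta\ell_i^-=(\tau q^D+\tau^{ -1})(q^{i-D}-1)\ell_{i-1}^++(\tau q^D+\tau^{ -1})q^{i-D}\ell_i^-+\tau(q^D-q^{i+1}+1)\ell_i^++\tau(1-q^{i+1})\ell_{i+1}^-,$$ $$\eta^{ -1}\ell_i^-=\tau^{ -1}(1-q^{i-D})\ell_{i-1}^-+(\tau q^D+\tau^{ -1})(1-q^{i-D})\ell_{i-1}^+-\tau(q^D-q^i+1)\ell_i^+,$$ $$\eta\ell_i^+=\tau^{ -1}(1-q^{i-D})\ell_{i-1}^+-\tau^{ -1}q^{i-D}\ell_i^-,$$ $$\eta^{ -1}\ell_i^+=\tau^{ -1}q^{i-D+1}\ell_i^-+(\tau q^D+\tau^{ -1})q^{i-D+1}\ell_i^++\tau(1-q^{i+1})\ell_{i+1}^+.$$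
   Context: Notation: $(r;q)_n=\prod_{k=0}^{n-1}(1-rq^k)$. Put $\tau=\sqrt{ -1}\,q^{ -(D+e)/2}$. For a nonzero scalar $s$ and an integer $d\ge 0$, and $0\le i\le d$, define the Laurent polynomial $$h_i(\eta;s,d;q)=\frac{(q^{ -d};q)_i}{s^i}\sum_{n=0}^{i}\frac{(q^{ -i};q)_n(s\eta^{ -1};q)_n(s\eta;q)_n}{(q^{ -d};q)_n(q;q)_n}q^n.$$ Let $h_i=h_i(\eta;\tau,D;q)$ ($0\le i\le D$), $h_i^\perp=h_i(\eta;\tau q,D-2;q)$ ($0\le i\le D-2$), $h_{ -1}^\perp=0$, $h_{D-1}^\perp=\eta^{1-D}\prod_{n=1}^{D-1}(\eta-\tau q^n)(\eta-\tau^{ -1}q^{ -n})$, and $p^\perp=\eta^{ -1}(\eta-\tau)(\eta-\tau^{ -1}q^{ -D})$. For $0\le i\le D-1$ define $$\ell_i^+=\frac{h_{i+1}-p^\perp h_i^\perp}{\tau^{i+1}(1-q^D)(q;q)_i},\qquad \ell_i^-=\frac{q^D-q^i}{\tau^i(q^D-1)(q;q)_i}\Big(h_i-\frac{1-q^i}{q^D-q^i}p^\perp h_{i-1}^\perp\Big)$$ (the non-symmetric dual $q$-Krawtchouk polynomials), and set $\ell_{ -1}^\pm=0$, $\ell_D^+=-\dfrac{\eta^{ -1}p^\perp h_{D-1}^\perp}{\tau^{D+1}(q;q)_D}$, $\ell_D^-=\dfrac{p^\perp h_{D-1}^\perp}{\tau^D(q;q)_D}$. -}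

module Defs where

open import Level using (Level; _⊔_) renaming (suc to lsuc)
open import Algebra.Bundles using (CommutativeRing)
open import Data.Nat as ℕ using (ℕ; zero; suc; _∸_; _≤_; _<_)
open import Data.Nat.Primality using (Prime)
open import Data.Integer as ℤ using (ℤ; +_; -[1+_])
open import Data.Product using (∃₂; _×_)
open import Data.Bool using (if_then_else_)
open import Relation.Nullary using (¬_; does)
open import Relation.Binary.PropositionalEquality using (_≡_)

-- A (discrete) field, presented as a commutative ring with a total
-- inverse function (the value of 0⁻¹ is unconstrained) that inverts
-- every nonzero element, and with 0 ≠ 1.
record Field (c ℓ : Level) : Set (lsuc (c ⊔ ℓ)) where
  field
    commutativeRing : CommutativeRing c ℓ
  open CommutativeRing commutativeRing public
  field
    _⁻¹       : Carrier → Carrier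
    ⁻¹-inverse : ∀ x → ¬ (x ≈ 0#) → x * (x ⁻¹) ≈ 1#
    0≉1       : ¬ (0# ≈ 1#)

module FieldOps {c ℓ} (K : Field c ℓ) where
  open Field K

  infixl 6 _−_
  infixl 7 _/_
  infixr 8 _^_ _^ℤ_

  _−_ : Carrier → Carrier → Carrier
  x − y = x + (- y)

  _/_ : Carrier → Carrier → Carrier
  x / y = x * (y ⁻¹)

  ι : ℕ → Carrier
  ι zero    = 0#
  ι (suc n) = 1# + ι n

  _^_ : Carrier → ℕ → Carrier
  x ^ zero  = 1#
  x ^ suc n = x * (x ^ n)

  _^ℤ_ : Carrier → ℤ → Carrier
  x ^ℤ (+ n)     = x ^ n
  x ^ℤ -[1+ n ]  = (x ^ suc n) ⁻¹

  Σ< : ℕ → (ℕ → Carrier) → Carrier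
  Σ< zero    f = 0#
  Σ< (suc n) f = Σ< n f + f n

  Π< : ℕ → (ℕ → Carrier) → Carrier
  Π< zero    f = 1#
  Π< (suc n) f = Π< n f * f n

CharZero : ∀ {c ℓ} → Field c ℓ → Set ℓ
CharZero K = ∀ n → ¬ (ι (suc n) ≈ 0#)
  where open Field K
        open FieldOps K

IsPrimePower : ℕ → Set
IsPrimePower n = ∃₂ λ p k → Prime p × 1 ≤ k × n ≡ p ℕ.^ k

data Param (q : ℕ) : Set where
  e0 e1 e2      : Param q
  e1/2 e3/2     : (r : ℕ) → r ℕ.* r ≡ q → Param q

-- The (positive) real number q^(D+e), as an element of K.
module Objects {c ℓ} (K : Field c ℓ) (qn : ℕ) (D : ℕ) where
  open Field K
  open FieldOps K

  q : Carrier
  q = ι qn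

  qPow : Param qn → Carrier
  qPow e0           = q ^ D
  qPow e1           = q ^ (D ℕ.+ 1)
  qPow e2           = q ^ (D ℕ.+ 2)
  qPow (e1/2 r _)   = ι r ^ (2 ℕ.* D ℕ.+ 1)
  qPow (e3/2 r _)   = ι r ^ (2 ℕ.* D ℕ.+ 3)

  module Poly (τ η : Carrier) where

    poch : Carrier → ℕ → Carrier
    poch r n = Π< n (λ k → 1# − (r * (q ^ k)))

    h : Carrier → ℕ → ℕ → Carrier
    h s d i =
      (poch ((q ^ d) ⁻¹) i / (s ^ i)) *
      Σ< (suc i) (λ n →
        ((poch (q ^ℤ (ℤ.- (+ i))) n * poch (s / η) n * poch (s * η) n)
          / (poch ((q ^ d) ⁻¹) n * poch q n)) * (q ^ n))

    hh : ℕ → Carrier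
    hh i = h τ D i

    h⊥top : Carrier
    h⊥top = (η ^ℤ (+ 1 ℤ.- + D)) *
            Π< (D ∸ 1) (λ k → (η − (τ * (q ^ suc k))) *
                                (η − ((τ ⁻¹) * (q ^ℤ -[1+ k ]))))

    h⊥ : ℤ → Carrier
    h⊥ -[1+ _ ] = 0#
    h⊥ (+ i)    = if does (i ℕ.≟ (D ∸ 1)) then h⊥top else h (τ * q) (D ∸ 2) i

    p⊥ : Carrier
    p⊥ = (η ⁻¹) * ((η − τ) * (η − ((τ ⁻¹) * (q ^ℤ (ℤ.- (+ D))))))

    ℓ⁺ : ℤ → Carrier
    ℓ⁺ -[1+ _ ] = 0#
    ℓ⁺ (+ i) =
      if does (i ℕ.≟ D)
      then - ((((η ⁻¹) * p⊥) * h⊥ (+ (D ∸ 1))) / ((τ ^ (D ℕ.+ 1)) * poch q D))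
      else (hh (suc i) − (p⊥ * h⊥ (+ i)))
             / (((τ ^ (suc i)) * (1# − (q ^ D))) * poch q i)

    ℓ⁻ : ℤ → Carrier
    ℓ⁻ -[1+ _ ] = 0#
    ℓ⁻ (+ i) =
      if does (i ℕ.≟ D)
      then (p⊥ * h⊥ (+ (D ∸ 1))) / ((τ ^ D) * poch q D)
      else ((q ^ D − q ^ i) / (((τ ^ i) * (q ^ D − 1#)) * poch q i)) *
           (hh i − (((1# − q ^ i) / (q ^ D − q ^ i)) * (p⊥ * h⊥ (+ i ℤ.- + 1))))

{-# OPTIONS --safe #-}

-- Put x = η⁻¹, W = q⁻ᴰ and expand everything in the Laurent polynomials
-- E n = (τx;q)ₙ (τqη;q)ₙ.  With the dual q-Krawtchouk sums
-- S i = Σₙ (Wq;q)ᵢ (q⁻ⁱ;q)ₙ qⁿ / ((Wq;q)ₙ (q;q)ₙ) E n, contiguous relations give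
--   (τq)ⁱ h i            = S i − τ x (1 − qⁱ) S (i − 1),
--   (τq)ⁱ⁺¹ p⊥ h⊥ i      = S (i + 1) − τ x (1 − W qⁱ⁺¹) S i,
-- so that ℓ⁺ i is a multiple of x S i and ℓ⁻ i is a multiple of
-- S i − τ x (1 − W qⁱ) (1 − qⁱ) S (i − 1).  The third identity is then
-- immediate, the fourth is the three-term recurrence of S, and the first two
-- follow from these by multiplying with η and η⁻¹.
module Submission where

open import Defs
open import Data.Nat as ℕ using (ℕ; _≤_; _<_)
open import Data.Integer as ℤ using (+_)
open import Data.Product using (_×_)
open import Relation.Nullary using (¬_)
open import Algebra.Bundles using (CommutativeRing)
import Algebra.Properties.CommutativeSemigroup as CommutativeSemigroupProperties
import Algebra.Properties.Ring as RingProperties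
import Algebra.Properties.Semiring.Mult.TCOptimised as Multiples
import Algebra.Solver.Ring as RingSolver
open import Algebra.Solver.Ring.AlmostCommutativeRing using (fromCommutativeRing; _-Raw-AlmostCommutative⟶_)
open import Data.Bool using (if_then_else_)
open import Data.Integer using (ℤ; -[1+_])
import Data.Integer.Properties as ℤₚ
open import Data.Maybe using (Maybe; just; nothing)
open import Data.Nat using (zero; suc; _∸_; z≤n; s≤s)
open import Data.Nat.Primality using (prime)
import Data.Nat.Properties as ℕₚ
open import Data.Product using (_,_)
open import Data.Sum using (inj₁; inj₂)
open import Relation.Binary.PropositionalEquality as ≡ using (_≡_)
import Relation.Binary.Reasoning.Setoid as SetoidReasoning
open import Relation.Nullary using (Dec; does; yes; no)
open import Relation.Nullary.Decidable using (dec-true; dec-false)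

-- The obstacle is vanishing denominators: `(V;q)ₙ` with `V = q¹⁻ᴰ` is zero at `n = D`, and
-- `(Vq;q)ₙ` is zero at `n = D - 1`. These are the rows where `ℓ_D` and `h⊥_{D-1}` have separate
-- definitions. The coefficients are therefore generated by a Pascal-type recurrence and related to
-- each other by denominator-free identities, so that the exceptional polynomials become ordinary
-- instances. The choice of `S` has a source: put `s = τ√q` and `y = √q η`. Then
-- `E n = (s/y;q)ₙ (sy;q)ₙ`, so for `i < D` the sum `S i` is `sⁱ` times the dual q-Krawtchouk
-- polynomial with parameters `(s, D - 1)` at `y`, halfway between those of `h` and `h⊥`. Only `s/y`
-- and `sy` occur, so no square root is taken; the rescaling of `η` is what breaks the symmetry
-- between `η` and `η⁻¹`.

-- Polynomial identities with integer coefficients.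

module IntegerSolver {c ℓ} (R : CommutativeRing c ℓ) where
  open CommutativeRing R
  open RingProperties ring using (-0#≈0#; -‿involutive; -‿+-comm; -‿distribˡ-*; -‿distribʳ-*)
  open Multiples semiring using (1+×; ×-homo-+; ×1-homo-*) renaming (_×_ to _·_)
  open CommutativeSemigroupProperties +-commutativeSemigroup using (interchange)
  open SetoidReasoning setoid

  private
    ⟦_⟧ : ℤ → Carrier
    ⟦ + n ⟧      = n · 1#
    ⟦ -[1+ n ] ⟧ = - (suc n · 1#)

    ⊖-homo : ∀ m n → ⟦ m ℤ.⊖ n ⟧ ≈ m · 1# + - (n · 1#)
    ⊖-homo zero    zero    = sym (trans (+-identityˡ _) -0#≈0#)
    ⊖-homo zero    (suc n) = sym (+-identityˡ _)
    ⊖-homo (suc m) zero    = sym (trans (+-congˡ -0#≈0#) (+-identityʳ _))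
    ⊖-homo (suc m) (suc n) = begin
      ⟦ suc m ℤ.⊖ suc n ⟧                   ≡⟨ ≡.cong ⟦_⟧ (ℤₚ.[1+m]⊖[1+n]≡m⊖n m n) ⟩
      ⟦ m ℤ.⊖ n ⟧                           ≈⟨ ⊖-homo m n ⟩
      m · 1# + - (n · 1#)                   ≈⟨ +-identityˡ _ ⟨
      0# + (m · 1# + - (n · 1#))            ≈⟨ +-congʳ (-‿inverseʳ 1#) ⟨
      (1# + - 1#) + (m · 1# + - (n · 1#))   ≈⟨ interchange _ _ _ _ ⟩
      (1# + m · 1#) + (- 1# + - (n · 1#))   ≈⟨ +-congˡ (-‿+-comm 1# (n · 1#)) ⟩
      (1# + m · 1#) + - (1# + n · 1#)       ≈⟨ +-cong (1+× m 1#) (-‿cong (1+× n 1#)) ⟨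
      suc m · 1# + - (suc n · 1#)           ∎

    -homo : ∀ i → ⟦ ℤ.- i ⟧ ≈ - ⟦ i ⟧
    -homo (+ zero)   = sym -0#≈0#
    -homo (+ suc n)  = refl
    -homo -[1+ n ]   = sym (-‿involutive _)

    +-homo : ∀ i j → ⟦ i ℤ.+ j ⟧ ≈ ⟦ i ⟧ + ⟦ j ⟧
    +-homo (+ m)    (+ n)    = ×-homo-+ 1# m n
    +-homo (+ m)    -[1+ n ] = ⊖-homo m (suc n)
    +-homo -[1+ m ] (+ n)    = trans (⊖-homo n (suc m)) (+-comm _ _)
    +-homo -[1+ m ] -[1+ n ] = begin
      - (suc (suc (m ℕ.+ n)) · 1#)            ≡⟨ ≡.cong (λ k → - (k · 1#)) (≡.cong suc (ℕₚ.+-suc m n)) ⟨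
      - ((suc m ℕ.+ suc n) · 1#)              ≈⟨ -‿cong (×-homo-+ 1# (suc m) (suc n)) ⟩
      - (suc m · 1# + suc n · 1#)             ≈⟨ -‿+-comm _ _ ⟨
      - (suc m · 1#) + - (suc n · 1#)         ∎

    *-homo-pos : ∀ m j → ⟦ + m ℤ.* j ⟧ ≈ ⟦ + m ⟧ * ⟦ j ⟧
    *-homo-pos m (+ n) = begin
      ⟦ + m ℤ.* + n ⟧    ≡⟨ ≡.cong ⟦_⟧ (ℤₚ.pos-* m n) ⟨
      (m ℕ.* n) · 1#     ≈⟨ ×1-homo-* m n ⟩
      m · 1# * n · 1#    ∎
    *-homo-pos m -[1+ n ] = begin
      ⟦ + m ℤ.* ℤ.- (+ suc n) ⟧   ≡⟨ ≡.cong ⟦_⟧ (ℤₚ.neg-distribʳ-* (+ m) (+ suc n)) ⟨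
      ⟦ ℤ.- (+ m ℤ.* + suc n) ⟧   ≈⟨ -homo (+ m ℤ.* + suc n) ⟩
      - ⟦ + m ℤ.* + suc n ⟧       ≈⟨ -‿cong (*-homo-pos m (+ suc n)) ⟩
      - (m · 1# * suc n · 1#)     ≈⟨ -‿distribʳ-* _ _ ⟩
      m · 1# * - (suc n · 1#)     ∎

    *-homo : ∀ i j → ⟦ i ℤ.* j ⟧ ≈ ⟦ i ⟧ * ⟦ j ⟧
    *-homo (+ m)    j = *-homo-pos m j
    *-homo -[1+ m ] j = begin
      ⟦ ℤ.- (+ suc m) ℤ.* j ⟧   ≡⟨ ≡.cong ⟦_⟧ (ℤₚ.neg-distribˡ-* (+ suc m) j) ⟨
      ⟦ ℤ.- (+ suc m ℤ.* j) ⟧   ≈⟨ -homo (+ suc m ℤ.* j) ⟩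
      - ⟦ + suc m ℤ.* j ⟧       ≈⟨ -‿cong (*-homo-pos (suc m) j) ⟩
      - (suc m · 1# * ⟦ j ⟧)    ≈⟨ -‿distribˡ-* _ _ ⟩
      - (suc m · 1#) * ⟦ j ⟧    ∎

    -- Equality in `R` need not be decidable, while normalisation has to compare coefficients.
    -- Coefficients are taken in `ℤ`, where this is possible, and carried to `R` by this
    -- homomorphism.
    morphism : ℤ.+-*-rawRing -Raw-AlmostCommutative⟶ fromCommutativeRing R
    morphism = record
      { ⟦_⟧    = ⟦_⟧
      ; +-homo = +-homo
      ; *-homo = *-homo
      ; -‿homo = -homo
      ; 0-homo = refl
      ; 1-homo = refl
      }

    _coeff≟_ : ∀ i j → Maybe (⟦ i ⟧ ≈ ⟦ j ⟧)
    i coeff≟ j with i ℤ.≟ j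
    ... | yes ≡.refl = just refl
    ... | no  _      = nothing

  open RingSolver ℤ.+-*-rawRing (fromCommutativeRing R) morphism _coeff≟_ public

  :1 : ∀ {n} → Polynomial n
  :1 = con (+ 1)

  :0 : ∀ {n} → Polynomial n
  :0 = con (+ 0)

primePower⇒1< : ∀ {n} → IsPrimePower n → 1 < n
primePower⇒1< (p , suc k , prime {{nontrivial}} _ , _ , ≡.refl) =
  ℕₚ.<-≤-trans 1<p (ℕₚ.m≤m*n p (p ℕ.^ k) {{ℕₚ.m^n≢0 p k {{ℕ.>-nonZero (ℕₚ.<-trans (s≤s z≤n) 1<p)}}}})
  where
  1<p : 1 < p
  1<p = ℕ.nonTrivial⇒n>1 p {{nontrivial}}

if-yes : ∀ {a b} {A : Set a} {B : Set b} {u v : B} (A? : Dec A) → A → (if does A? then u else v) ≡ u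
if-yes A? p rewrite dec-true A? p = ≡.refl

if-no : ∀ {a b} {A : Set a} {B : Set b} {u v : B} (A? : Dec A) → ¬ A → (if does A? then u else v) ≡ v
if-no A? ¬p rewrite dec-false A? ¬p = ≡.refl

-- Field arithmetic, finite sums and products.

module OverField {c ℓ} (K : Field c ℓ) where
  open Field K hiding (zero)
  open FieldOps K
  open IntegerSolver commutativeRing
  open SetoidReasoning setoid

  infixr 7 _⊙_
  infixl 6 _⊕_

  -- With `⊕`, a list of terms `cofactor ⊙ equation` forms an ideal-membership certificate: the
  -- cofactors are chosen so that what remains of the goal is an identity of commutative rings,
  -- which `solve` checks.
  _⊙_ : ∀ k {a b} → a ≈ b → k * a ≈ k * b
  k ⊙ a≈b = *-congˡ a≈b

  _⊕_ : ∀ {a b a′ b′} → a ≈ b → a′ ≈ b′ → a + a′ ≈ b + b′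
  _⊕_ = +-cong

  -- Proves l ≈ r from an identity a ≈ b with l − r = a − b; the second
  -- argument is a polynomial identity.
  linear-combination : ∀ {l r a b} → a ≈ b → l + b ≈ r + a → l ≈ r
  linear-combination {l} {r} {a} {b} a≈b l+b≈r+a = begin
    l              ≈⟨ solve 2 (λ l b → l := (l :+ b) :- b) refl l b ⟩
    (l + b) − b    ≈⟨ +-cong l+b≈r+a (-‿cong (sym a≈b)) ⟩
    (r + a) − a    ≈⟨ solve 2 (λ r a → (r :+ a) :- a := r) refl r a ⟩
    r              ∎

  *-cancelˡ-nonzero : ∀ {u a b} → ¬ (u ≈ 0#) → u * a ≈ u * b → a ≈ b
  *-cancelˡ-nonzero {u} {a} {b} u≉0 ua≈ub =
    linear-combination ((u ⁻¹) ⊙ ua≈ub ⊕ (b − a) ⊙ ⁻¹-inverse u u≉0)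
      (solve 4 (λ u v a b → a :+ (v :* (u :* b) :+ (b :- a) :* :1)
                          := b :+ (v :* (u :* a) :+ (b :- a) :* (u :* v)))
             refl u (u ⁻¹) a b)

  *-nonzero : ∀ {a b} → ¬ (a ≈ 0#) → ¬ (b ≈ 0#) → ¬ (a * b ≈ 0#)
  *-nonzero a≉0 b≉0 ab≈0 = b≉0 (*-cancelˡ-nonzero a≉0 (trans ab≈0 (sym (zeroʳ _))))

  1≉0 : ¬ (1# ≈ 0#)
  1≉0 1≈0 = 0≉1 (sym 1≈0)

  ^-nonzero : ∀ {a} n → ¬ (a ≈ 0#) → ¬ (a ^ n ≈ 0#)
  ^-nonzero zero    a≉0 = 1≉0
  ^-nonzero (suc n) a≉0 = *-nonzero a≉0 (^-nonzero n a≉0)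

  −-nonzero : ∀ {a b} → ¬ (a ≈ b) → ¬ (a − b ≈ 0#)
  −-nonzero {a} {b} a≉b a−b≈0 = a≉b (linear-combination a−b≈0
    (solve 2 (λ a b → a :+ :0 := b :+ (a :- b)) refl a b))

  ⁻¹-inverseˡ : ∀ a → ¬ (a ≈ 0#) → (a ⁻¹) * a ≈ 1#
  ⁻¹-inverseˡ a a≉0 = trans (*-comm _ _) (⁻¹-inverse a a≉0)

  *-/-cancel : ∀ a {b} → ¬ (b ≈ 0#) → b * (a / b) ≈ a
  *-/-cancel a {b} b≉0 = linear-combination (a ⊙ ⁻¹-inverse b b≉0)
    (solve 3 (λ a b v → b :* (a :* v) :+ a :* :1 := a :+ a :* (b :* v)) refl a b (b ⁻¹))

  ^-+ : ∀ a m n → a ^ (m ℕ.+ n) ≈ a ^ m * a ^ n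
  ^-+ a zero    n = sym (*-identityˡ _)
  ^-+ a (suc m) n = trans (*-congˡ (^-+ a m n)) (sym (*-assoc _ _ _))

  ^-inverse : ∀ {a b} n → a * b ≈ 1# → a ^ n * b ^ n ≈ 1#
  ^-inverse zero    ab≈1 = *-identityˡ 1#
  ^-inverse {a} {b} (suc n) ab≈1 = linear-combination ((a * b) ⊙ ^-inverse n ab≈1 ⊕ ab≈1)
    (solve 4 (λ a b A B → (a :* A) :* (b :* B) :+ (a :* b :* :1 :+ :1)
                        := :1 :+ (a :* b :* (A :* B) :+ a :* b))
           refl a b (a ^ n) (b ^ n))

  Σ<-cong : ∀ n {f g} → (∀ {k} → k < n → f k ≈ g k) → Σ< n f ≈ Σ< n g
  Σ<-cong zero    f≈g = refl
  Σ<-cong (suc n) f≈g = +-cong (Σ<-cong n (λ k<n → f≈g (ℕₚ.m<n⇒m<1+n k<n))) (f≈g (ℕₚ.n<1+n n))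

  Σ<-zero : ∀ n {f} → (∀ {k} → k < n → f k ≈ 0#) → Σ< n f ≈ 0#
  Σ<-zero zero    f≈0 = refl
  Σ<-zero (suc n) f≈0 =
    trans (+-cong (Σ<-zero n (λ k<n → f≈0 (ℕₚ.m<n⇒m<1+n k<n))) (f≈0 (ℕₚ.n<1+n n))) (+-identityˡ 0#)

  *-distribˡ-Σ< : ∀ a n f → a * Σ< n f ≈ Σ< n (λ k → a * f k)
  *-distribˡ-Σ< a zero    f = zeroʳ a
  *-distribˡ-Σ< a (suc n) f = trans (distribˡ a _ _) (+-congʳ (*-distribˡ-Σ< a n f))

  Π<-cong : ∀ n {f g} → (∀ k → f k ≈ g k) → Π< n f ≈ Π< n g
  Π<-cong zero    f≈g = refl
  Π<-cong (suc n) f≈g = *-cong (Π<-cong n f≈g) (f≈g n)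

  Π<-nonzero : ∀ n {f} → (∀ {k} → k < n → ¬ (f k ≈ 0#)) → ¬ (Π< n f ≈ 0#)
  Π<-nonzero zero    f≉0 = 1≉0
  Π<-nonzero (suc n) f≉0 = *-nonzero (Π<-nonzero n (λ k<n → f≉0 (ℕₚ.m<n⇒m<1+n k<n))) (f≉0 (ℕₚ.n<1+n n))

  *-^ : ∀ a b n → (a * b) ^ n ≈ a ^ n * b ^ n
  *-^ a b zero    = sym (*-identityˡ 1#)
  *-^ a b (suc n) = linear-combination ((a * b) ⊙ *-^ a b n)
    (solve 5 (λ a b A B C → (a :* b) :* C :+ a :* b :* (A :* B) := (a :* A) :* (b :* B) :+ a :* b :* C)
      refl a b (a ^ n) (b ^ n) ((a * b) ^ n))

  Σ<-extend : ∀ {m n f} → m ≤ n → (∀ {k} → m ≤ k → f k ≈ 0#) → Σ< n f ≈ Σ< m f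
  Σ<-extend {zero} {n} _ f≈0 = Σ<-zero n (λ _ → f≈0 z≤n)
  Σ<-extend {suc m} {suc n} {f} (s≤s m≤n) f≈0 with ℕₚ.m≤n⇒m<n∨m≡n m≤n
  ... | inj₁ m<n = trans (+-cong (Σ<-extend m<n f≈0) (f≈0 m<n)) (+-identityʳ _)
  ... | inj₂ ≡.refl = refl

  module Naturals (charZero : CharZero K) where
    ι-+ : ∀ m n → ι (m ℕ.+ n) ≈ ι m + ι n
    ι-+ zero    n = sym (+-identityˡ _)
    ι-+ (suc m) n = trans (+-congˡ (ι-+ m n)) (sym (+-assoc _ _ _))

    ι-* : ∀ m n → ι (m ℕ.* n) ≈ ι m * ι n
    ι-* zero    n = sym (zeroˡ _)
    ι-* (suc m) n = trans (ι-+ n (m ℕ.* n)) (linear-combination (ι-* m n)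
      (solve 3 (λ a b c → (b :+ c) :+ a :* b := (:1 :+ a) :* b :+ c) refl (ι m) (ι n) (ι (m ℕ.* n))))

    ι-^ : ∀ m n → ι (m ℕ.^ n) ≈ ι m ^ n
    ι-^ m zero    = +-identityʳ 1#
    ι-^ m (suc n) = trans (ι-* m (m ℕ.^ n)) (*-congˡ (ι-^ m n))

    ι-injective : ∀ {m n} → m < n → ¬ (ι m ≈ ι n)
    ι-injective {zero}  {suc n} _         ιm≈ιn = charZero n (sym ιm≈ιn)
    ι-injective {suc m} {suc n} (s≤s m<n) ιm≈ιn = ι-injective m<n (linear-combination ιm≈ιn
      (solve 2 (λ a b → a :+ (:1 :+ b) := b :+ (:1 :+ a)) refl (ι m) (ι n)))

    -- Characteristic zero carries strict monotonicity of powers from `ℕ` to the field. So `q` is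
    -- not a root of unity, which is why `(q;q)ₙ` and differences of distinct powers of `q` can be
    -- cancelled.
    ι-^-injective : ∀ {b m n} → 1 < b → m < n → ¬ (ι b ^ m ≈ ι b ^ n)
    ι-^-injective {b} {m} {n} 1<b m<n eq =
      ι-injective (ℕₚ.^-monoʳ-< b 1<b m<n) (trans (ι-^ b m) (trans eq (sym (ι-^ b n))))

  -- The coefficients `β` and their contiguous relations.

  module Coefficients (q : Carrier) (q≉0 : ¬ (q ≈ 0#)) where

    p : Carrier
    p = q ⁻¹

    qp≈1 : q * p ≈ 1#
    qp≈1 = ⁻¹-inverse q q≉0

    q^p^≈1 : ∀ n → q ^ n * p ^ n ≈ 1#
    q^p^≈1 n = ^-inverse n qp≈1

    q^≉0 : ∀ n → ¬ (q ^ n ≈ 0#)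
    q^≉0 n = ^-nonzero n q≉0

    poch : Carrier → ℕ → Carrier
    poch r n = Π< n (λ k → 1# − (r * (q ^ k)))

    -- β V i n = (V;q)ᵢ (q⁻ⁱ;q)ₙ qⁿ / ((V;q)ₙ (q;q)ₙ), defined through its
    -- Pascal-type recurrence so that no denominator can vanish.
    β : Carrier → ℕ → ℕ → Carrier
    β V zero    zero    = 1#
    β V zero    (suc n) = 0#
    β V (suc i) zero    = (1# − V * q ^ i) * β V i zero
    β V (suc i) (suc n) = (p ^ suc n − V * q ^ i) * β V i (suc n) − p ^ n * β V i n

    β-cong : ∀ {V V′} i n → V ≈ V′ → β V i n ≈ β V′ i n
    β-cong zero    zero    V≈V′ = refl
    β-cong zero    (suc n) V≈V′ = refl
    β-cong (suc i) zero    V≈V′ = *-cong (+-congˡ (-‿cong (*-congʳ V≈V′))) (β-cong i zero V≈V′)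
    β-cong (suc i) (suc n) V≈V′ =
      +-cong (*-cong (+-congˡ (-‿cong (*-congʳ V≈V′))) (β-cong i (suc n) V≈V′))
             (-‿cong (*-congˡ (β-cong i n V≈V′)))

    β-upper : ∀ V {i n} → i < n → β V i n ≈ 0#
    β-upper V {zero}  {suc n} _         = refl
    β-upper V {suc i} {suc n} (s≤s i<n) =
      linear-combination ((p ^ suc n − V * q ^ i) ⊙ β-upper V (ℕₚ.m<n⇒m<1+n i<n) ⊕ (- (p ^ n)) ⊙ β-upper V i<n)
        (solve 4 (λ k P a b → (k :* a :- P :* b) :+ (k :* :0 :+ :- P :* :0) := :0 :+ (k :* a :+ :- P :* b))
               refl (p ^ suc n − V * q ^ i) (p ^ n) (β V i (suc n)) (β V i n))

    β-diagonal : ∀ V i → β V (suc i) (suc i) ≈ - (p ^ i * β V i i)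
    β-diagonal V i = linear-combination ((p ^ suc i − V * q ^ i) ⊙ β-upper V (ℕₚ.n<1+n i))
      (solve 3 (λ k a b → (k :* a :- b) :+ k :* :0 := :- b :+ k :* a)
             refl (p ^ suc i − V * q ^ i) (β V i (suc i)) (p ^ i * β V i i))

    β-pascal : ∀ V i n → (q * q ^ n) * β V (suc i) (suc n)
             ≈ (1# − V * (q ^ i * (q * q ^ n))) * β V i (suc n) − q * β V i n
    β-pascal V i n =
      linear-combination ((q * p * a − q * b) ⊙ q^p^≈1 n ⊕ a ⊙ qp≈1)
        (solve 8 (λ q p V I Q P a b →
          q :* Q :* ((p :* P :- V :* I) :* a :- P :* b) :+ ((q :* p :* a :- q :* b) :* :1 :+ a :* :1)
          := ((:1 :- V :* (I :* (q :* Q))) :* a :- q :* b) :+ ((q :* p :* a :- q :* b) :* (Q :* P) :+ a :* (q :* p)))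
          refl q p V (q ^ i) (q ^ n) (p ^ n) a b)
      where a = β V i (suc n)
            b = β V i n

    -- The hypergeometric term ratio `q (1 - qⁿ⁻ⁱ) / ((1 - V qⁿ)(1 - qⁿ⁺¹))` along a row, cleared of
    -- denominators so that it survives `V qⁿ = 1`. In the induction on `i`, `β-pascal` rewrites
    -- both entries of row `i + 1` by three entries of row `i`, which two induction hypotheses
    -- relate.
    β-horizontal : ∀ V i n → q ^ i * (β V i (suc n) * ((1# − q * q ^ n) * (1# − V * q ^ n)))
                 ≈ q * ((q ^ i − q ^ n) * β V i n)
    β-horizontal V zero zero =
      solve 2 (λ q V → :1 :* (:0 :* ((:1 :- q :* :1) :* (:1 :- V :* :1))) := q :* ((:1 :- :1) :* :1)) refl q V
    β-horizontal V zero (suc n) =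
      solve 3 (λ q V Q → :1 :* (:0 :* ((:1 :- q :* Q) :* (:1 :- V :* Q))) := q :* ((:1 :- Q) :* :0)) refl q V (q ^ suc n)
    β-horizontal V (suc i) zero = *-cancelˡ-nonzero (q^≉0 1) (linear-combination
      ((q * q ^ i * ((1# − q * 1#) * (1# − V * 1#))) ⊙ β-pascal V i 0
        ⊕ (q * (1# − V * (q ^ i * (q * 1#)))) ⊙ β-horizontal V i 0)
      (solve 6 (λ q V I a b c →
         (q :* :1) :* ((q :* I) :* (c :* ((:1 :- q :* :1) :* (:1 :- V :* :1))))
         :+ (q :* I :* ((:1 :- q :* :1) :* (:1 :- V :* :1)) :* ((:1 :- V :* (I :* (q :* :1))) :* a :- q :* b)
           :+ q :* (:1 :- V :* (I :* (q :* :1))) :* (q :* ((I :- :1) :* b)))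
         := (q :* :1) :* (q :* ((q :* I :- :1) :* ((:1 :- V :* I) :* b)))
         :+ (q :* I :* ((:1 :- q :* :1) :* (:1 :- V :* :1)) :* ((q :* :1) :* c)
           :+ q :* (:1 :- V :* (I :* (q :* :1))) :* (I :* (a :* ((:1 :- q :* :1) :* (:1 :- V :* :1))))))
       refl q V (q ^ i) (β V i 1) (β V i 0) (β V (suc i) 1)))
    β-horizontal V (suc i) (suc n) = *-cancelˡ-nonzero (q^≉0 (2 ℕ.+ n)) (linear-combination
      ((q * I * ((1# − q * (q * M)) * (1# − V * (q * M)))) ⊙ β-pascal V i (suc n)
        ⊕ (q * (1# − V * (I * (q * (q * M))))) ⊙ β-horizontal V i (suc n)
        ⊕ (- (q * q * (q * I − q * M))) ⊙ β-pascal V i n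
        ⊕ (- (q * q * q)) ⊙ β-horizontal V i n)
      (solve 9 (λ q V I M a b c x y →
         (q :* (q :* M)) :* ((q :* I) :* (x :* ((:1 :- q :* (q :* M)) :* (:1 :- V :* (q :* M)))))
         :+ (q :* I :* ((:1 :- q :* (q :* M)) :* (:1 :- V :* (q :* M)))
               :* ((:1 :- V :* (I :* (q :* (q :* M)))) :* a :- q :* b)
             :+ q :* (:1 :- V :* (I :* (q :* (q :* M)))) :* (q :* ((I :- q :* M) :* b))
             :+ :- (q :* q :* (q :* I :- q :* M)) :* ((:1 :- V :* (I :* (q :* M))) :* b :- q :* c)
             :+ :- (q :* q :* q) :* (q :* ((I :- M) :* c)))
         := (q :* (q :* M)) :* (q :* ((q :* I :- q :* M) :* y))
         :+ (q :* I :* ((:1 :- q :* (q :* M)) :* (:1 :- V :* (q :* M))) :* ((q :* (q :* M)) :* x)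
             :+ q :* (:1 :- V :* (I :* (q :* (q :* M)))) :* (I :* (a :* ((:1 :- q :* (q :* M)) :* (:1 :- V :* (q :* M)))))
             :+ :- (q :* q :* (q :* I :- q :* M)) :* ((q :* M) :* y)
             :+ :- (q :* q :* q) :* (I :* (b :* ((:1 :- q :* M) :* (:1 :- V :* M))))))
       refl q V I M (β V i (2 ℕ.+ n)) (β V i (1 ℕ.+ n)) (β V i n) (β V (suc i) (2 ℕ.+ n)) (β V (suc i) (1 ℕ.+ n))))
      where I = q ^ i
            M = q ^ n

    -- Multiplying `β-pascal` by `qⁿ - qⁱ` lets `β-horizontal` turn its neighbour term `β V i n`
    -- into a multiple of `β V i (suc n)`, so a single column remains.
    β-vertical : ∀ V i n → (q ^ n − q * q ^ i) * β V (suc i) n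
               ≈ (1# − V * q ^ i) * ((1# − q * q ^ i) * β V i n)
    β-vertical V i zero =
      solve 4 (λ q V I b → (:1 :- q :* I) :* ((:1 :- V :* I) :* b) := (:1 :- V :* I) :* ((:1 :- q :* I) :* b))
        refl q V (q ^ i) (β V i 0)
    β-vertical V i (suc n) = *-cancelˡ-nonzero (q^≉0 n) (linear-combination
      ((q ^ n − q ^ i) ⊙ β-pascal V i n ⊕ (- 1#) ⊙ β-horizontal V i n)
      (solve 7 (λ q V I Q a b x →
         Q :* ((q :* Q :- q :* I) :* x)
         :+ ((Q :- I) :* ((:1 :- V :* (I :* (q :* Q))) :* a :- q :* b) :+ :- :1 :* (q :* ((I :- Q) :* b)))
         := Q :* ((:1 :- V :* I) :* ((:1 :- q :* I) :* a))
         :+ ((Q :- I) :* ((q :* Q) :* x) :+ :- :1 :* (I :* (a :* ((:1 :- q :* Q) :* (:1 :- V :* Q))))))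
       refl q V (q ^ i) (q ^ n) (β V i (suc n)) (β V i n) (β V (suc i) (suc n))))

    β-contiguous-zero : ∀ V i → β V (suc i) 0 ≈ (1# − V) * β (V * q) i 0
    β-contiguous-zero V zero = solve 1 (λ V → (:1 :- V :* :1) :* :1 := (:1 :- V) :* :1) refl V
    β-contiguous-zero V (suc i) = linear-combination ((1# − V * (q * q ^ i)) ⊙ β-contiguous-zero V i)
      (solve 5 (λ q V I a b → (:1 :- V :* (q :* I)) :* a :+ (:1 :- V :* (q :* I)) :* ((:1 :- V) :* b)
                          := (:1 :- V) :* ((:1 :- V :* q :* I) :* b) :+ (:1 :- V :* (q :* I)) :* a)
        refl q V (q ^ i) (β V (suc i) 0) (β (V * q) i 0))

    -- A second Pascal rule, which also moves the parameter. The induction on `i` works because `V`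
    -- in row `i + 1` and `V * q` in row `i` contribute the same term `V qⁱ⁺¹` to the defining
    -- recurrence.
    β-contiguous-suc : ∀ V i n → β V (suc i) (suc n)
                     ≈ (1# − V * (q * q ^ n)) * β (V * q) i (suc n) − p ^ i * β (V * q) i n
    β-contiguous-suc V zero zero = solve 3 (λ q p V →
      (p :* :1 :- V :* :1) :* :0 :- :1 :* :1 := (:1 :- V :* (q :* :1)) :* :0 :- :1 :* :1) refl q p V
    β-contiguous-suc V zero (suc n) = solve 4 (λ q V P Q →
      (P :- V :* :1) :* :0 :- Q :* :0 := (:1 :- V :* q) :* :0 :- :1 :* :0)
      refl (q * q ^ suc n) V (p ^ suc (suc n)) (p ^ suc n)
    β-contiguous-suc V (suc i) zero = linear-combination
      ((p * 1# − V * (q * I)) ⊙ β-contiguous-suc V i 0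
        ⊕ (- 1#) ⊙ β-contiguous-zero V i
        ⊕ (V * q * b − V * q * p * b) ⊙ q^p^≈1 i
        ⊕ (- (V * b)) ⊙ qp≈1)
      (solve 9 (λ q p V I J a b u w →
         ((p :* :1 :- V :* (q :* I)) :* u :- :1 :* w)
         :+ ((p :* :1 :- V :* (q :* I)) :* ((:1 :- V :* (q :* :1)) :* a :- J :* b)
             :+ :- :1 :* ((:1 :- V) :* b)
             :+ (V :* q :* b :- V :* q :* p :* b) :* :1
             :+ :- (V :* b) :* :1)
         := ((:1 :- V :* (q :* :1)) :* ((p :* :1 :- V :* q :* I) :* a :- :1 :* b)
             :- (p :* J) :* ((:1 :- V :* q :* I) :* b))
         :+ ((p :* :1 :- V :* (q :* I)) :* u
             :+ :- :1 :* w
             :+ (V :* q :* b :- V :* q :* p :* b) :* (I :* J)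
             :+ :- (V :* b) :* (q :* p)))
       refl q p V I (p ^ i) (β (V * q) i 1) b (β V (suc i) 1) (β V (suc i) 0))
      where I = q ^ i
            b = β (V * q) i 0
    β-contiguous-suc V (suc i) (suc n) = linear-combination
      ((p * (p * P) − V * (q * I)) ⊙ β-contiguous-suc V i (suc n)
        ⊕ (- (p * P)) ⊙ β-contiguous-suc V i n
        ⊕ (V * q * b − V * q * p * b) ⊙ q^p^≈1 i
        ⊕ (V * q * p * b − V * q * q * p * b) ⊙ q^p^≈1 n
        ⊕ (- (V * q * b)) ⊙ qp≈1)
      (solve 12 (λ q p V I J M P a b c u w →
         ((p :* (p :* P) :- V :* (q :* I)) :* u :- (p :* P) :* w)
         :+ ((p :* (p :* P) :- V :* (q :* I)) :* ((:1 :- V :* (q :* (q :* M))) :* a :- J :* b)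
             :+ :- (p :* P) :* ((:1 :- V :* (q :* M)) :* b :- J :* c)
             :+ (V :* q :* b :- V :* q :* p :* b) :* :1
             :+ (V :* q :* p :* b :- V :* q :* q :* p :* b) :* :1
             :+ :- (V :* q :* b) :* :1)
         := ((:1 :- V :* (q :* (q :* M))) :* ((p :* (p :* P) :- V :* q :* I) :* a :- (p :* P) :* b)
             :- (p :* J) :* ((p :* P :- V :* q :* I) :* b :- P :* c))
         :+ ((p :* (p :* P) :- V :* (q :* I)) :* u
             :+ :- (p :* P) :* w
             :+ (V :* q :* b :- V :* q :* p :* b) :* (I :* J)
             :+ (V :* q :* p :* b :- V :* q :* q :* p :* b) :* (M :* P)
             :+ :- (V :* q :* b) :* (q :* p)))
       refl q p V I (p ^ i) (q ^ n) P (β (V * q) i (2 ℕ.+ n)) b (β (V * q) i n)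
         (β V (suc i) (2 ℕ.+ n)) (β V (suc i) (suc n)))
      where I = q ^ i
            P = p ^ n
            b = β (V * q) i (suc n)

    β-contiguous : ∀ V i n → q ^ i * β V (suc i) (suc n)
                 ≈ q ^ i * ((1# − V * (q * q ^ n)) * β (V * q) i (suc n)) − β (V * q) i n
    β-contiguous V i n = linear-combination
      ((q ^ i) ⊙ β-contiguous-suc V i n ⊕ (- b) ⊙ q^p^≈1 i)
      (solve 5 (λ I J u a b → I :* u :+ (I :* (a :- J :* b) :+ :- b :* :1)
                            := (I :* a :- b) :+ (I :* u :+ :- b :* (I :* J)))
       refl (q ^ i) (p ^ i) (β V (suc i) (suc n)) ((1# − V * (q * q ^ n)) * β (V * q) i (suc n)) b)
      where b = β (V * q) i n

    -- In closed form the factor `1 - V` cancels between `(V;q)ᵢ₊₁` and `(V;q)ₙ₊₁`, so both indices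
    -- drop while `V` becomes `V q`. Without quotients: `β-horizontal` eliminates
    -- `β (V * q) i (suc n)` from `β-contiguous`.
    β-lower : ∀ V i n → (1# − q * q ^ n) * (q ^ i * β V (suc i) (suc n))
            ≈ - ((1# − q * q ^ i) * β (V * q) i n)
    β-lower V i n = linear-combination
      ((1# − q * q ^ n) ⊙ β-contiguous V i n ⊕ β-horizontal (V * q) i n)
      (solve 7 (λ q V I Q a b u →
         (:1 :- q :* Q) :* (I :* u)
         :+ ((:1 :- q :* Q) :* (I :* ((:1 :- V :* (q :* Q)) :* a) :- b) :+ q :* ((I :- Q) :* b))
         := :- ((:1 :- q :* I) :* b)
         :+ ((:1 :- q :* Q) :* (I :* u) :+ I :* (a :* ((:1 :- q :* Q) :* (:1 :- V :* q :* Q)))))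
       refl q V (q ^ i) (q ^ n) (β (V * q) i (suc n)) (β (V * q) i n) (β V (suc i) (suc n)))

    -- The difference of two Pascal rules in which `β (V * q) i n` cancels. It serves to replace the
    -- parameter `W` of `h` by the parameter of `S` in `Φ-partial-sum`.
    β-mixed : ∀ V i n → (q * q ^ i) * β V (suc i) n + (1# − q * q ^ i) * β (V * q) i n
            ≈ q ^ n * β (V * q) (suc i) n
    β-mixed V i zero = linear-combination ((q * q ^ i) ⊙ β-contiguous-zero V i)
      (solve 5 (λ q V I u b →
         ((q :* I) :* u :+ (:1 :- q :* I) :* b) :+ (q :* I) :* ((:1 :- V) :* b)
         := :1 :* ((:1 :- V :* q :* I) :* b) :+ (q :* I) :* u)
       refl q V (q ^ i) (β V (suc i) 0) (β (V * q) i 0))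
    β-mixed V i (suc n) = linear-combination (q ⊙ β-contiguous V i n ⊕ (- 1#) ⊙ β-pascal (V * q) i n)
      (solve 8 (λ q V I Q u w a b →
         ((q :* I) :* u :+ (:1 :- q :* I) :* a)
         :+ (q :* (I :* ((:1 :- V :* (q :* Q)) :* a) :- b)
             :+ :- :1 :* ((:1 :- V :* q :* (I :* (q :* Q))) :* a :- q :* b))
         := (q :* Q) :* w :+ (q :* (I :* u) :+ :- :1 :* ((q :* Q) :* w)))
       refl q V (q ^ i) (q ^ n) (β V (suc i) (suc n)) (β (V * q) (suc i) (suc n)) (β (V * q) i (suc n)) (β (V * q) i n))

    -- Reflects `(1 - V) (Vq;q)ₖ = (1 - V qᵏ) (V;q)ₖ` for `k = i` and `k = n`. Together with
    -- `β-raise` it brings the parameter of `h⊥` down to that of `S` in `Ψ-partial-sum`.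
    β-shift : ∀ V i n → (1# − V * q ^ n) * β (V * q) i n ≈ (1# − V * q ^ i) * β V i n
    β-shift V zero zero = refl
    β-shift V zero (suc n) =
      solve 2 (λ a b → a :* :0 := b :* :0) refl (1# − V * q ^ suc n) (1# − V * 1#)
    β-shift V (suc i) zero = linear-combination ((- (1# − V * (q * q ^ i))) ⊙ β-contiguous-zero V i)
      (solve 5 (λ q V I u b →
         (:1 :- V :* :1) :* ((:1 :- V :* q :* I) :* b) :+ :- (:1 :- V :* (q :* I)) :* ((:1 :- V) :* b)
         := (:1 :- V :* (q :* I)) :* u :+ :- (:1 :- V :* (q :* I)) :* u)
       refl q V (q ^ i) (β V (suc i) 0) (β (V * q) i 0))
    β-shift V (suc i) (suc n) =
      *-cancelˡ-nonzero (*-nonzero (q^≉0 i) (q^≉0 (suc n))) (linear-combination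
      ((I * (1# − V * (q * Q))) ⊙ β-pascal (V * q) i n
        ⊕ (- ((1# − V * (q * I)) * (q * Q))) ⊙ β-contiguous V i n
        ⊕ β-horizontal (V * q) i n)
      (solve 8 (λ q V I Q u w a b →
         (I :* (q :* Q)) :* ((:1 :- V :* (q :* Q)) :* w)
         :+ (I :* (:1 :- V :* (q :* Q)) :* ((:1 :- V :* q :* (I :* (q :* Q))) :* a :- q :* b)
             :+ :- ((:1 :- V :* (q :* I)) :* (q :* Q)) :* (I :* ((:1 :- V :* (q :* Q)) :* a) :- b)
             :+ q :* ((I :- Q) :* b))
         := (I :* (q :* Q)) :* ((:1 :- V :* (q :* I)) :* u)
         :+ (I :* (:1 :- V :* (q :* Q)) :* ((q :* Q) :* w)
             :+ :- ((:1 :- V :* (q :* I)) :* (q :* Q)) :* (I :* u)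
             :+ I :* (a :* ((:1 :- q :* Q) :* (:1 :- V :* q :* Q)))))
       refl q V I Q (β V (suc i) (suc n)) (β (V * q) (suc i) (suc n)) (β (V * q) i (suc n)) (β (V * q) i n)))
      where I = q ^ i
            Q = q ^ n

    β-raise : ∀ V i n → (q * q ^ n) * β V (suc i) (suc n)
            ≈ (1# − V * (q * q ^ n)) * β (V * q) i (suc n) − q * β (V * q) i n
    β-raise V i n = *-cancelˡ-nonzero (q^≉0 i) (linear-combination
      ((q * q ^ n) ⊙ β-contiguous V i n ⊕ (- 1#) ⊙ β-horizontal (V * q) i n)
      (solve 7 (λ q V I Q u a b →
         I :* ((q :* Q) :* u)
         :+ ((q :* Q) :* (I :* ((:1 :- V :* (q :* Q)) :* a) :- b) :+ :- :1 :* (q :* ((I :- Q) :* b)))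
         := I :* ((:1 :- V :* (q :* Q)) :* a :- q :* b)
         :+ ((q :* Q) :* (I :* u) :+ :- :1 :* (I :* (a :* ((:1 :- q :* Q) :* (:1 :- V :* q :* Q))))))
       refl q V (q ^ i) (q ^ n) (β V (suc i) (suc n)) (β (V * q) i (suc n)) (β (V * q) i n)))

    β-zero : ∀ V i → β V i 0 ≈ poch V i
    β-zero V zero    = refl
    β-zero V (suc i) = trans (*-comm _ _) (*-congʳ (β-zero V i))

    -- The link to the quotient in the definition of `h`. `J` abstracts `q⁻ⁱ`, which is written
    -- there as an integer power.
    β-closed : ∀ V i n {J} → J * q ^ i ≈ 1# →
               β V i n * (poch V n * poch q n) ≈ (poch V i * poch J n) * q ^ n
    β-closed V i zero JI≈1 = linear-combination (β-zero V i)
      (solve 2 (λ a v → a :* (:1 :* :1) :+ v := (v :* :1) :* :1 :+ a) refl (β V i 0) (poch V i))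
    β-closed V i (suc n) {J} JI≈1 = linear-combination
      ((J * v * w) ⊙ β-horizontal V i n
        ⊕ (q * b * v * w − a * ((1# − q * Q) * (1# − V * Q)) * v * w) ⊙ JI≈1
        ⊕ (q * (1# − J * Q)) ⊙ β-closed V i n JI≈1)
      (solve 11 (λ q V I J Q a b v w c d →
         a :* ((v :* (:1 :- V :* Q)) :* (w :* (:1 :- q :* Q)))
         :+ (J :* v :* w :* (q :* ((I :- Q) :* b))
             :+ (q :* b :* v :* w :- a :* ((:1 :- q :* Q) :* (:1 :- V :* Q)) :* v :* w) :* :1
             :+ q :* (:1 :- J :* Q) :* ((c :* d) :* Q))
         := (c :* (d :* (:1 :- J :* Q))) :* (q :* Q)
         :+ (J :* v :* w :* (I :* (a :* ((:1 :- q :* Q) :* (:1 :- V :* Q))))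
             :+ (q :* b :* v :* w :- a :* ((:1 :- q :* Q) :* (:1 :- V :* Q)) :* v :* w) :* (J :* I)
             :+ q :* (:1 :- J :* Q) :* (b :* (v :* w))))
       refl q V (q ^ i) J Q a b v w (poch V i) (poch J n))
      where a = β V i (suc n)
            b = β V i n
            v = poch V n
            w = poch q n
            Q = q ^ n

  -- Expansions in the basis `E` and relations between the sums.

  module Expansions (q : Carrier) (q≉0 : ¬ (q ≈ 0#))
                    (τ η x W : Carrier) (ηx≈1 : η * x ≈ 1#) where
    open Coefficients q q≉0

    poch-cong : ∀ n {r r′} → r ≈ r′ → poch r n ≈ poch r′ n
    poch-cong n r≈r′ = Π<-cong n (λ _ → +-congˡ (-‿cong (*-congʳ r≈r′)))

    poch-shift : ∀ r n → poch r (suc n) ≈ (1# − r) * poch (r * q) n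
    poch-shift r zero = solve 1 (λ r → :1 :* (:1 :- r :* :1) := (:1 :- r) :* :1) refl r
    poch-shift r (suc n) = linear-combination ((1# − r * (q * q ^ n)) ⊙ poch-shift r n)
      (solve 5 (λ q r Q a b →
         a :* (:1 :- r :* (q :* Q)) :+ (:1 :- r :* (q :* Q)) :* ((:1 :- r) :* b)
         := (:1 :- r) :* (b :* (:1 :- r :* q :* Q)) :+ (:1 :- r :* (q :* Q)) :* a)
       refl q r (q ^ n) (poch r (suc n)) (poch (r * q) n))

    -- Once `W = q⁻ᴰ`, the values `W`, `V`, `V * q` are `q⁻ᴰ`, `q¹⁻ᴰ`, `q²⁻ᴰ`, the parameters
    -- belonging to `h`, `S` and `h⊥`.
    V : Carrier
    V = W * q

    -- The basis interlaces the symmetric products Φ n and Ψ n, which lets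
    -- multiplication by η and η⁻¹ act by short recurrences.
    E Φ Ψ : ℕ → Carrier
    E n = poch (τ * x) n * poch ((τ * q) * η) n
    Φ n = poch (τ * x) n * poch (τ * η) n
    Ψ n = poch ((τ * q) * x) n * poch ((τ * q) * η) n

    -- Trades the first factor of `(τη;q)ₙ₊₁` for a new last one, by `qⁿ⁺¹ (1 - τη) = (1 - τη qⁿ⁺¹)
    -- + (qⁿ⁺¹ - 1)`.
    Φ-suc : ∀ n → (q * q ^ n) * Φ (suc n) ≈ E (suc n) + (q * q ^ n − 1#) * ((1# − τ * x * q ^ n) * E n)
    Φ-suc n = linear-combination
      ((q * q ^ n * (poch (τ * x) n * (1# − τ * x * q ^ n))) ⊙
        trans (poch-shift (τ * η) n) (*-congˡ (poch-cong n (solve 3 (λ τ η q → τ :* η :* q := τ :* q :* η) refl τ η q))))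
      (solve 8 (λ q τ η x Q v w u →
         (q :* Q) :* ((v :* (:1 :- τ :* x :* Q)) :* u)
         :+ (q :* Q :* (v :* (:1 :- τ :* x :* Q))) :* ((:1 :- τ :* η) :* w)
         := ((v :* (:1 :- τ :* x :* Q)) :* (w :* (:1 :- τ :* q :* η :* Q))
             :+ (q :* Q :- :1) :* ((:1 :- τ :* x :* Q) :* (v :* w)))
         :+ (q :* Q :* (v :* (:1 :- τ :* x :* Q))) :* u)
       refl q τ η x (q ^ n) (poch (τ * x) n) (poch ((τ * q) * η) n) (poch (τ * η) (suc n)))

    Ψ-E : ∀ n → (1# − τ * x) * Ψ n ≈ (1# − τ * x * q ^ n) * E n
    Ψ-E n = linear-combination
      ((- poch ((τ * q) * η) n) ⊙
        trans (poch-shift (τ * x) n) (*-congˡ (poch-cong n (solve 3 (λ τ x q → τ :* x :* q := τ :* q :* x) refl τ x q))))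
      (solve 5 (λ r v u w Q →
         ((:1 :- r) :* (u :* w) :+ :- w :* ((:1 :- r) :* u))
         := (:1 :- r :* Q) :* (v :* w) :+ :- w :* (v :* (:1 :- r :* Q)))
       refl (τ * x) (poch (τ * x) n) (poch ((τ * q) * x) n) (poch ((τ * q) * η) n) (q ^ n))

    -- Here `qⁿ⁺¹ (τη - W)` splits as `(1 - W qⁿ⁺¹) - (1 - τη qⁿ⁺¹)`, where the second term raises
    -- `E`. The prefactor `(τη - W)(1 - τx)` is `τ p⊥`.
    Ψ-suc : ∀ n → (q * q ^ n) * ((τ * η − W) * ((1# − τ * x) * Ψ n))
          ≈ (1# − V * q ^ n) * ((1# − τ * x * q ^ n) * E n) − E (suc n)
    Ψ-suc n = linear-combination ((q * q ^ n * (τ * η − W)) ⊙ Ψ-E n)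
      (solve 9 (λ q τ η x W Q v w u →
         (q :* Q) :* ((τ :* η :- W) :* u)
         :+ q :* Q :* (τ :* η :- W) :* ((:1 :- τ :* x :* Q) :* (v :* w))
         := ((:1 :- W :* q :* Q) :* ((:1 :- τ :* x :* Q) :* (v :* w))
              :- (v :* (:1 :- τ :* x :* Q)) :* (w :* (:1 :- τ :* q :* η :* Q)))
         :+ q :* Q :* (τ :* η :- W) :* u)
       refl q τ η x W (q ^ n) (poch (τ * x) n) (poch ((τ * q) * η) n) ((1# − τ * x) * Ψ n))

    -- The length `N` is free to allow induction on it. The weight `qⁿ - qⁱ` of `T` is the one that
    -- `β-vertical` absorbs when passing to row `i - 1`.
    S T : ℕ → ℕ → Carrier
    S N i = Σ< N (λ n → β V i n * E n)
    T N i = Σ< N (λ n → (q ^ n − q ^ i) * (β V i n * E n))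

    -- In this and the next two sums the last summand is the telescoped remainder
    -- of an induction on N; it vanishes once N exceeds the row index.
    Φ-partial-sum : ∀ i N → (q * q ^ i) * Σ< N (λ n → β W (suc i) n * Φ n)
      ≈ (S N (suc i) − τ * x * ((1# − q * q ^ i) * S N i))
        − q * q ^ i * β W (suc i) N * (Φ N − p ^ N * E N)
    Φ-partial-sum i zero =
      solve 4 (λ J r I b → J :* :0 := (:0 :- r :* (I :* :0)) :- J :* b :* (:1 :* :1 :- :1 :* (:1 :* :1)))
        refl (q * q ^ i) (τ * x) (1# − q * q ^ i) (β W (suc i) 0)
    Φ-partial-sum i (suc N) = *-cancelˡ-nonzero (q^≉0 N) (linear-combination
      (Q ⊙ Φ-partial-sum i N
        ⊕ (q * I * b * e) ⊙ q^p^≈1 N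
        ⊕ (I * b′) ⊙ Φ-suc N
        ⊕ (- (I * b′ * e′)) ⊙ q^p^≈1 (suc N)
        ⊕ (- ((1# − τ * x * Q) * e)) ⊙ β-lower W i N
        ⊕ e ⊙ β-mixed W i N)
      (solve 17 (λ q p r I Q P b b′ g₁ g₀ a a′ e e′ s s₁ s₀ →
        Q :* ((q :* I) :* (s :+ b :* a))
        :+ (Q :* ((s₁ :- r :* ((:1 :- q :* I) :* s₀)) :- q :* I :* b :* (a :- P :* e))
            :+ q :* I :* b :* e :* :1
            :+ I :* b′ :* (e′ :+ (q :* Q :- :1) :* ((:1 :- r :* Q) :* e))
            :+ :- (I :* b′ :* e′) :* :1
            :+ :- ((:1 :- r :* Q) :* e) :* :- ((:1 :- q :* I) :* g₀)
            :+ e :* (Q :* g₁))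
        := Q :* (((s₁ :+ g₁ :* e) :- r :* ((:1 :- q :* I) :* (s₀ :+ g₀ :* e)))
                 :- q :* I :* b′ :* (a′ :- p :* P :* e′))
        :+ (Q :* ((q :* I) :* s)
            :+ q :* I :* b :* e :* (Q :* P)
            :+ I :* b′ :* ((q :* Q) :* a′)
            :+ :- (I :* b′ :* e′) :* ((q :* Q) :* (p :* P))
            :+ :- ((:1 :- r :* Q) :* e) :* ((:1 :- q :* Q) :* (I :* b′))
            :+ e :* ((q :* I) :* b :+ (:1 :- q :* I) :* g₀)))
       refl q p (τ * x) I Q (p ^ N) b b′ (β V (suc i) N) (β V i N) (Φ N) (Φ (suc N)) e e′
         (Σ< N (λ n → β W (suc i) n * Φ n)) (S N (suc i)) (S N i)))
      where I = q ^ i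
            Q = q ^ N
            b = β W (suc i) N
            b′ = β W (suc i) (suc N)
            e = E N
            e′ = E (suc N)

    -- Since `ηx = 1`, expanding the two new factors of `E (suc n)` gives `τ (x + qη) E n = q⁻ⁿ (E n
    -- - E (suc n)) + q τ² qⁿ E
    -- n`. Collecting coefficients of `E`, the part with `q⁻ⁿ` together with `- V
    -- qⁱ` is exactly the defining recurrence of `β`; the part with `qⁿ` is shared between `T` and the multiple of `S`.
    S-partial-recurrence : ∀ i N → S N (suc i)
      ≈ ((τ * x + q * τ * η − τ * τ * q * q ^ i − V * q ^ i) * S N i − q * τ * τ * T N i)
        − (β V (suc i) N − (p ^ N − V * q ^ i) * β V i N) * E N
    S-partial-recurrence i zero =
      solve 4 (λ k t v b → :0 := (k :* :0 :- t :* :0) :- ((:1 :- v) :* b :- (:1 :- v) :* b) :* (:1 :* :1))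
        refl (τ * x + q * τ * η − τ * τ * q * q ^ i − V * q ^ i) (q * τ * τ) (V * q ^ i) (β V i 0)
    S-partial-recurrence i (suc N) = linear-combination
      (S-partial-recurrence i N
        ⊕ (b * (v * w) * (τ * (x + q * η) − q * τ * τ * Q * (η * x))) ⊙ q^p^≈1 N
        ⊕ (- (b * (v * w) * (q * τ * τ * Q))) ⊙ ηx≈1)
      (solve 17 (λ q p τ η x V I Q P b b′ g v w s₁ s₀ t →
        (s₁ :+ g :* (v :* w))
        :+ ((((τ :* x :+ q :* τ :* η :- τ :* τ :* q :* I :- V :* I) :* s₀ :- q :* τ :* τ :* t)
             :- (g :- (P :- V :* I) :* b) :* (v :* w))
            :+ b :* (v :* w) :* (τ :* (x :+ q :* η) :- q :* τ :* τ :* Q :* (η :* x)) :* :1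
            :+ :- (b :* (v :* w) :* (q :* τ :* τ :* Q)) :* :1)
        := (((τ :* x :+ q :* τ :* η :- τ :* τ :* q :* I :- V :* I) :* (s₀ :+ b :* (v :* w))
              :- q :* τ :* τ :* (t :+ (Q :- I) :* (b :* (v :* w))))
             :- (((p :* P :- V :* I) :* b′ :- P :* b) :- (p :* P :- V :* I) :* b′)
                :* ((v :* (:1 :- τ :* x :* Q)) :* (w :* (:1 :- τ :* q :* η :* Q))))
        :+ (s₁
            :+ b :* (v :* w) :* (τ :* (x :+ q :* η) :- q :* τ :* τ :* Q :* (η :* x)) :* (Q :* P)
            :+ :- (b :* (v :* w) :* (q :* τ :* τ :* Q)) :* (η :* x)))
       refl q p τ η x V (q ^ i) Q (p ^ N) b (β V i (suc N)) (β V (suc i) N) v w (S N (suc i)) (S N i) (T N i))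
      where Q = q ^ N
            b = β V i N
            v = poch (τ * x) N
            w = poch ((τ * q) * η) N

    Ψ-partial-sum : ∀ i N →
      q * ((τ * η − W) * ((1# − τ * x) * Σ< N (λ n → β (V * q) i n * Ψ n)))
      ≈ (S N (suc i) − τ * x * ((1# − V * q ^ i) * S N i))
        + (β V (suc i) N − p ^ N * ((1# − V * q ^ N) * β (V * q) i N)) * E N
    Ψ-partial-sum i zero = linear-combination ((- 1#) ⊙ β-contiguous-zero V i)
      (solve 8 (λ q a b r k u V g →
         q :* (a :* (b :* :0)) :+ :- :1 :* ((:1 :- V) :* g)
         := ((:0 :- r :* (k :* :0)) :+ (u :- :1 :* ((:1 :- V :* :1) :* g)) :* (:1 :* :1)) :+ :- :1 :* u)
        refl q (τ * η − W) (1# − τ * x) (τ * x) (1# − V * q ^ i) (β V (suc i) 0) V (β (V * q) i 0))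
    Ψ-partial-sum i (suc N) = *-cancelˡ-nonzero (q^≉0 (suc N)) (linear-combination
      ((q * Q) ⊙ Ψ-partial-sum i N
        ⊕ (q * g) ⊙ Ψ-suc N
        ⊕ (- e′) ⊙ β-raise V i N
        ⊕ ((1# − V * (q * Q)) * g′ * e′) ⊙ q^p^≈1 (suc N)
        ⊕ (- (q * (1# − V * Q) * g * e)) ⊙ q^p^≈1 N
        ⊕ (- (q * (τ * x) * Q * e)) ⊙ β-shift V i N)
      (solve 19 (λ q p r m V I Q P b₁ b₁′ b g g′ e e′ ψ s₁ s₀ s →
        (q :* Q) :* (q :* (m :* ((:1 :- r) :* (s :+ g :* ψ))))
        :+ ((q :* Q) :* ((s₁ :- r :* ((:1 :- V :* I) :* s₀)) :+ (b₁ :- P :* ((:1 :- V :* Q) :* g)) :* e)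
            :+ q :* g :* ((:1 :- V :* Q) :* ((:1 :- r :* Q) :* e) :- e′)
            :+ :- e′ :* ((:1 :- V :* (q :* Q)) :* g′ :- q :* g)
            :+ (:1 :- V :* (q :* Q)) :* g′ :* e′ :* :1
            :+ :- (q :* (:1 :- V :* Q) :* g :* e) :* :1
            :+ :- (q :* r :* Q :* e) :* ((:1 :- V :* I) :* b))
        := (q :* Q) :* (((s₁ :+ b₁ :* e) :- r :* ((:1 :- V :* I) :* (s₀ :+ b :* e)))
                        :+ (b₁′ :- p :* P :* ((:1 :- V :* (q :* Q)) :* g′)) :* e′)
        :+ ((q :* Q) :* (q :* (m :* ((:1 :- r) :* s)))
            :+ q :* g :* ((q :* Q) :* (m :* ((:1 :- r) :* ψ)))
            :+ :- e′ :* ((q :* Q) :* b₁′)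
            :+ (:1 :- V :* (q :* Q)) :* g′ :* e′ :* ((q :* Q) :* (p :* P))
            :+ :- (q :* (:1 :- V :* Q) :* g :* e) :* (Q :* P)
            :+ :- (q :* r :* Q :* e) :* ((:1 :- V :* Q) :* g)))
       refl q p (τ * x) (τ * η − W) V (q ^ i) Q (p ^ N) (β V (suc i) N) (β V (suc i) (suc N)) (β V i N)
         g g′ e e′ (Ψ N) (S N (suc i)) (S N i) (Σ< N (λ n → β (V * q) i n * Ψ n))))
      where Q = q ^ N
            g = β (V * q) i N
            g′ = β (V * q) i (suc N)
            e = E N
            e′ = E (suc N)

    -- Stands for `S (i - 1)`. The default at zero is safe because the relations below multiply it
    -- by `1 - qⁱ`, which is zero there.
    S⁻ : ℕ → ℕ → Carrier
    S⁻ N zero    = 0#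
    S⁻ N (suc i) = S N i

    Φ-sum : ∀ {i N} → i < N →
      q ^ i * Σ< N (λ n → β W i n * Φ n) ≈ S N i − τ * x * ((1# − q ^ i) * S⁻ N i)
    Φ-sum {zero} {N} _ = linear-combination (Σ<-cong N (λ {n} _ → terms n))
      (solve 3 (λ a s r → :1 :* a :+ s := (s :- r :* ((:1 :- :1) :* :0)) :+ a)
        refl (Σ< N (λ n → β W 0 n * Φ n)) (S N 0) (τ * x))
      where
      terms : ∀ n → β W 0 n * Φ n ≈ β V 0 n * E n
      terms zero    = refl
      terms (suc n) = trans (zeroˡ _) (sym (zeroˡ _))
    Φ-sum {suc i} {N} i<N = linear-combination
      (Φ-partial-sum i N ⊕ (- (q * q ^ i * (Φ N − p ^ N * E N))) ⊙ β-upper W i<N)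
      (solve 5 (λ l r k b d → l :+ ((r :- k :* b :* d) :+ :- (k :* d) :* :0) := r :+ (l :+ :- (k :* d) :* b))
        refl ((q * q ^ i) * Σ< N (λ n → β W (suc i) n * Φ n))
        (S N (suc i) − τ * x * ((1# − q * q ^ i) * S N i)) (q * q ^ i) (β W (suc i) N) (Φ N − p ^ N * E N))

    S-recurrence : ∀ {i N} → suc i < N → S N (suc i)
      ≈ (τ * x + q * τ * η − τ * τ * q * q ^ i − V * q ^ i) * S N i − q * τ * τ * T N i
    S-recurrence {i} {N} i<N = linear-combination
      (S-partial-recurrence i N
        ⊕ (- E N) ⊙ β-upper V i<N
        ⊕ ((p ^ N − V * q ^ i) * E N) ⊙ β-upper V (ℕₚ.<-trans (ℕₚ.n<1+n i) i<N))
      (solve 6 (λ l r k b₁ b e →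
        l :+ ((r :- (b₁ :- k :* b) :* e) :+ :- e :* :0 :+ k :* e :* :0)
        := r :+ (l :+ :- e :* b₁ :+ k :* e :* b))
        refl (S N (suc i))
        ((τ * x + q * τ * η − τ * τ * q * q ^ i − V * q ^ i) * S N i − q * τ * τ * T N i)
        (p ^ N − V * q ^ i) (β V (suc i) N) (β V i N) (E N))

    Ψ-sum : ∀ {i N} → suc i < N →
      q * ((τ * η − W) * ((1# − τ * x) * Σ< N (λ n → β (V * q) i n * Ψ n)))
      ≈ S N (suc i) − τ * x * ((1# − V * q ^ i) * S N i)
    Ψ-sum {i} {N} i<N = linear-combination
      (Ψ-partial-sum i N
        ⊕ (- (- E N)) ⊙ β-upper V i<N
        ⊕ (- (p ^ N * (1# − V * q ^ N) * E N)) ⊙ β-upper (V * q) (ℕₚ.<-trans (ℕₚ.n<1+n i) i<N))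
      (solve 7 (λ l r P k b₁ b e →
        l :+ ((r :+ (b₁ :- P :* (k :* b)) :* e) :+ :- (:- e) :* :0 :+ :- (P :* k :* e) :* :0)
        := r :+ (l :+ :- (:- e) :* b₁ :+ :- (P :* k :* e) :* b))
        refl (q * ((τ * η − W) * ((1# − τ * x) * Σ< N (λ n → β (V * q) i n * Ψ n))))
        (S N (suc i) − τ * x * ((1# − V * q ^ i) * S N i))
        (p ^ N) (1# − V * q ^ N) (β V (suc i) N) (β (V * q) i N) (E N))

    -- Makes `S-recurrence` a three-term one. In row zero every summand vanishes: the weight at
    -- `n = 0`, the coefficient at `n > 0`.
    T-S⁻ : ∀ i N → T N i ≈ (1# − W * q ^ i) * ((1# − q ^ i) * S⁻ N i)
    T-S⁻ zero N = trans (Σ<-zero N (λ {n} _ → terms n))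
      (solve 1 (λ w → :0 := (:1 :- w) :* ((:1 :- :1) :* :0)) refl (W * 1#))
      where
      terms : ∀ n → (q ^ n − 1#) * (β V 0 n * E n) ≈ 0#
      terms zero    = solve 1 (λ e → (:1 :- :1) :* (:1 :* e) := :0) refl (E 0)
      terms (suc n) = solve 2 (λ k e → k :* (:0 :* e) := :0) refl (q ^ suc n − 1#) (E (suc n))
    T-S⁻ (suc i) N = trans (Σ<-cong N (λ {n} _ → terms n)) (trans (sym (*-distribˡ-Σ< k N _))
      (solve 4 (λ q W I s → (:1 :- W :* q :* I) :* (:1 :- q :* I) :* s := (:1 :- W :* (q :* I)) :* ((:1 :- q :* I) :* s))
        refl q W (q ^ i) (S N i)))
      where
      k : Carrier
      k = (1# − V * q ^ i) * (1# − q * q ^ i)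
      terms : ∀ n → (q ^ n − q * q ^ i) * (β V (suc i) n * E n) ≈ k * (β V i n * E n)
      terms n = linear-combination (E n ⊙ β-vertical V i n)
        (solve 6 (λ d u a b c e → d :* (u :* e) :+ e :* (a :* (c :* b)) := a :* c :* (b :* e) :+ e :* (d :* u))
          refl (q ^ n − q * q ^ i) (β V (suc i) n) (1# − V * q ^ i) (β V i n) (1# − q * q ^ i) (E n))

  -- The polynomials `h` and `h⊥` in terms of `S`.

  module Polynomials (qn d : ℕ) (q≉0 : ¬ (ι qn ≈ 0#))
                     (q-injective : ∀ {m n} → m < n → ¬ (ι qn ^ m ≈ ι qn ^ n))
                     (τ η : Carrier) (τ≉0 : ¬ (τ ≈ 0#)) (η≉0 : ¬ (η ≈ 0#)) where
    -- Written as a double successor so that `D ∸ 1`, `D ∸ 2` and the exponents `- D` and `1 - D`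
    -- compute.
    D : ℕ
    D = suc (suc d)

    open Objects K qn D
    open Coefficients q q≉0
    open Poly τ η hiding (poch)

    x W : Carrier
    x = η ⁻¹
    W = (q ^ D) ⁻¹

    ηx≈1 : η * x ≈ 1#
    ηx≈1 = ⁻¹-inverse η η≉0

    Wq^D≈1 : W * q ^ D ≈ 1#
    Wq^D≈1 = ⁻¹-inverseˡ _ (q^≉0 D)

    open Expansions q q≉0 τ η x W ηx≈1

    poch-q-nonzero : ∀ n → ¬ (poch q n ≈ 0#)
    poch-q-nonzero n = Π<-nonzero n (λ {k} _ → −-nonzero (q-injective {0} {suc k} (s≤s z≤n)))

    poch-inverse-nonzero : ∀ {m V n} → V * q ^ m ≈ 1# → n ≤ m → ¬ (poch V n ≈ 0#)
    poch-inverse-nonzero {m} {V} {n} Vq^m≈1 n≤m = Π<-nonzero n (λ {k} k<n → −-nonzero (λ 1≈Vq^k →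
      q-injective (ℕₚ.<-≤-trans k<n n≤m) (linear-combination
        ((- (q ^ m)) ⊙ 1≈Vq^k ⊕ (- (q ^ k)) ⊙ Vq^m≈1)
        (solve 3 (λ V a b → b :+ (:- a :* (V :* b) :+ :- b :* :1) := a :+ (:- a :* :1 :+ :- b :* (V :* a)))
          refl V (q ^ m) (q ^ k)))))

    q^ℤ-neg : ∀ k → q ^ℤ (ℤ.- (+ k)) * q ^ k ≈ 1#
    q^ℤ-neg zero    = *-identityˡ 1#
    q^ℤ-neg (suc k) = ⁻¹-inverseˡ _ (q^≉0 (suc k))

    -- Here the quotients of the definition are legitimate: `n ≤ i ≤ m` keeps `(q⁻ᵐ;q)ₙ` away from
    -- its first zero factor.
    h-sum : ∀ {s m i} → ¬ (s ≈ 0#) → i ≤ m →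
      s ^ i * h s m i ≈ Σ< (suc i) (λ n → β ((q ^ m) ⁻¹) i n * (poch (s / η) n * poch (s * η) n))
    h-sum {s} {m} {i} s≉0 i≤m = trans
      (linear-combination ((poch U i * Σ< (suc i) f) ⊙ ⁻¹-inverse (s ^ i) (^-nonzero i s≉0))
        (solve 4 (λ a t t⁻¹ σ → t :* (a :* t⁻¹ :* σ) :+ a :* σ :* :1 := a :* σ :+ a :* σ :* (t :* t⁻¹))
          refl (poch U i) (s ^ i) ((s ^ i) ⁻¹) (Σ< (suc i) f)))
      (trans (*-distribˡ-Σ< (poch U i) (suc i) f) (Σ<-cong (suc i) terms))
      where
      U J : Carrier
      U = (q ^ m) ⁻¹
      J = q ^ℤ (ℤ.- (+ i))
      f : ℕ → Carrier
      f n = ((poch J n * poch (s / η) n * poch (s * η) n) / (poch U n * poch q n)) * q ^ n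
      terms : ∀ {n} → n < suc i → poch U i * f n ≈ β U i n * (poch (s / η) n * poch (s * η) n)
      terms {n} (s≤s n≤i) = linear-combination
        ((β U i n * (a * b)) ⊙ ⁻¹-inverse w w≉0 ⊕ (- (a * b * w ⁻¹)) ⊙ β-closed U i n (q^ℤ-neg i))
        (solve 8 (λ v j a b w w⁻¹ Q g →
          v :* (((j :* a :* b) :* w⁻¹) :* Q) :+ (g :* (a :* b) :* :1 :+ :- (a :* b :* w⁻¹) :* ((v :* j) :* Q))
          := g :* (a :* b) :+ (g :* (a :* b) :* (w :* w⁻¹) :+ :- (a :* b :* w⁻¹) :* (g :* w)))
         refl (poch U i) (poch J n) a b w (w ⁻¹) (q ^ n) (β U i n))
        where
        a b w : Carrier
        a = poch (s / η) n
        b = poch (s * η) n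
        w = poch U n * poch q n
        w≉0 : ¬ (w ≈ 0#)
        w≉0 = *-nonzero (poch-inverse-nonzero (⁻¹-inverseˡ _ (q^≉0 m)) (ℕₚ.≤-trans n≤i i≤m)) (poch-q-nonzero n)

    -- One common length for all sums: every row up to `D` is exhausted before `N`, so sums over
    -- different rows can be combined.
    N : ℕ
    N = suc D

    hh-sum : ∀ {i} → i ≤ D → τ ^ i * hh i ≈ Σ< N (λ n → β W i n * Φ n)
    hh-sum {i} i≤D = trans (h-sum τ≉0 i≤D)
      (sym (Σ<-extend (s≤s i≤D) (λ i<k → trans (*-congʳ (β-upper W i<k)) (zeroˡ _))))

    τq≉0 : ¬ (τ * q ≈ 0#)
    τq≉0 = *-nonzero τ≉0 q≉0

    -- At i = D − 1 the coefficients with n < i vanish, since V q q^(D−2) = 1,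
    -- so a single term survives and it is the separately defined top polynomial.
    β-top : ∀ {n} → n < suc d → β (V * q) (suc d) n ≈ 0#
    β-top {n} n≤d = *-cancelˡ-nonzero (−-nonzero (q-injective n≤d))
      (trans (β-vertical (V * q) d n) (linear-combination ((- k) ⊙ Wq^D≈1)
        (solve 5 (λ q W I m k → (:1 :- W :* q :* q :* I) :* k :+ :- k :* :1 := m :* :0 :+ :- k :* (W :* (q :* (q :* I))))
          refl q W (q ^ d) (q ^ n − q * q ^ d) k)))
      where k = (1# − q * q ^ d) * β (V * q) d n

    -- Factor by factor: `η - τ qᵏ⁺¹ = η (1 - τ x qᵏ⁺¹)` and `τ q (η - τ⁻¹ q⁻ᵏ⁻¹) = - q⁻ᵏ (1 - τη
    -- qᵏ⁺¹)`. The constants `- q⁻ᵏ` accumulate to the diagonal coefficient by `β-diagonal`.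
    top-product : ∀ m → (τ * q) ^ m * Π< m (λ k → (η − (τ * (q ^ suc k))) * (η − ((τ ⁻¹) * (q ^ℤ -[1+ k ]))))
                ≈ η ^ m * (β (V * q) m m * Ψ m)
    top-product zero = solve 0 (:1 :* :1 := :1 :* (:1 :* (:1 :* :1))) refl
    top-product (suc m) = *-cancelˡ-nonzero (q^≉0 m) (linear-combination
      ((τ * q * Q * ((η − τ * (q * Q)) * (η − σ * R))) ⊙ top-product m
        ⊕ (- (Q * η * H * Ψ′)) ⊙ β-diagonal (V * q) m
        ⊕ (η * H * g * Ψ′) ⊙ q^p^≈1 m
        ⊕ (- ((η − τ * (q * Q)) * (H * g * v * w) * (q * Q * R))) ⊙ ⁻¹-inverse τ τ≉0
        ⊕ (- ((η − τ * (q * Q)) * (H * g * v * w))) ⊙ ⁻¹-inverse (q ^ suc m) (q^≉0 (suc m))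
        ⊕ (- (τ * q * Q * (1# − τ * q * η * Q) * (H * g * v * w))) ⊙ ηx≈1)
      (solve 15 (λ q τ η x σ Q P R H g g′ v w y π →
        Q :* (((τ :* q) :* y) :* (π :* ((η :- τ :* (q :* Q)) :* (η :- σ :* R))))
        :+ (τ :* q :* Q :* ((η :- τ :* (q :* Q)) :* (η :- σ :* R)) :* (H :* (g :* (v :* w)))
            :+ :- (Q :* η :* H :* ((v :* (:1 :- τ :* q :* x :* Q)) :* (w :* (:1 :- τ :* q :* η :* Q)))) :* (:- (P :* g))
            :+ η :* H :* g :* ((v :* (:1 :- τ :* q :* x :* Q)) :* (w :* (:1 :- τ :* q :* η :* Q))) :* :1
            :+ :- ((η :- τ :* (q :* Q)) :* (H :* g :* v :* w) :* (q :* Q :* R)) :* :1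
            :+ :- ((η :- τ :* (q :* Q)) :* (H :* g :* v :* w)) :* :1
            :+ :- (τ :* q :* Q :* (:1 :- τ :* q :* η :* Q) :* (H :* g :* v :* w)) :* :1)
        := Q :* ((η :* H) :* (g′ :* ((v :* (:1 :- τ :* q :* x :* Q)) :* (w :* (:1 :- τ :* q :* η :* Q)))))
        :+ (τ :* q :* Q :* ((η :- τ :* (q :* Q)) :* (η :- σ :* R)) :* (y :* π)
            :+ :- (Q :* η :* H :* ((v :* (:1 :- τ :* q :* x :* Q)) :* (w :* (:1 :- τ :* q :* η :* Q)))) :* g′
            :+ η :* H :* g :* ((v :* (:1 :- τ :* q :* x :* Q)) :* (w :* (:1 :- τ :* q :* η :* Q))) :* (Q :* P)
            :+ :- ((η :- τ :* (q :* Q)) :* (H :* g :* v :* w) :* (q :* Q :* R)) :* (τ :* σ)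
            :+ :- ((η :- τ :* (q :* Q)) :* (H :* g :* v :* w)) :* ((q :* Q) :* R)
            :+ :- (τ :* q :* Q :* (:1 :- τ :* q :* η :* Q) :* (H :* g :* v :* w)) :* (η :* x)))
       refl q τ η x σ Q (p ^ m) R H g (β (V * q) (suc m) (suc m)) v w ((τ * q) ^ m) π))
      where
      Q R σ H g v w Ψ′ π : Carrier
      Q = q ^ m
      R = (q ^ suc m) ⁻¹
      σ = τ ⁻¹
      H = η ^ m
      g = β (V * q) m m
      v = poch ((τ * q) * x) m
      w = poch ((τ * q) * η) m
      Ψ′ = Ψ (suc m)
      π = Π< m (λ k → (η − (τ * (q ^ suc k))) * (η − ((τ ⁻¹) * (q ^ℤ -[1+ k ]))))

    h⊥-last : h⊥ (+ suc d) ≡ h⊥top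
    h⊥-last = if-yes (suc d ℕ.≟ suc d) ≡.refl

    h⊥-below : ∀ {i} → i ≤ d → h⊥ (+ i) ≡ h (τ * q) d i
    h⊥-below {i} i≤d = if-no (i ℕ.≟ suc d) (ℕₚ.<⇒≢ (s≤s i≤d))

    h⊥-short-sum : ∀ {i} → i ≤ suc d → (τ * q) ^ i * h⊥ (+ i) ≈ Σ< (suc i) (λ n → β (V * q) i n * Ψ n)
    h⊥-short-sum {i} i≤1+d with ℕₚ.m≤n⇒m<n∨m≡n i≤1+d
    ... | inj₁ (s≤s i≤d) = begin
      (τ * q) ^ i * h⊥ (+ i)                             ≡⟨ ≡.cong ((τ * q) ^ i *_) (h⊥-below i≤d) ⟩
      (τ * q) ^ i * h (τ * q) d i                        ≈⟨ h-sum τq≉0 i≤d ⟩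
      Σ< (suc i) (λ n → β ((q ^ d) ⁻¹) i n * Ψ n)        ≈⟨ Σ<-cong (suc i) (λ {n} _ → *-congʳ (β-cong i n shift)) ⟩
      Σ< (suc i) (λ n → β (V * q) i n * Ψ n)             ∎
      where
      shift : (q ^ d) ⁻¹ ≈ V * q
      shift = *-cancelˡ-nonzero (q^≉0 d) (trans (⁻¹-inverse _ (q^≉0 d)) (linear-combination ((- 1#) ⊙ Wq^D≈1)
        (solve 3 (λ q W Q → :1 :+ :- :1 :* :1 := Q :* (W :* q :* q) :+ :- :1 :* (W :* (q :* (q :* Q)))) refl q W (q ^ d))))
    ... | inj₂ ≡.refl = begin
      (τ * q) ^ suc d * h⊥ (+ suc d)                                  ≡⟨ ≡.cong ((τ * q) ^ suc d *_) h⊥-last ⟩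
      -- The exponent `1 - D` has computed to a negative literal, so the power of `η` in `h⊥top`
      -- unfolds to this inverse.
      (τ * q) ^ suc d * ((η ^ suc d) ⁻¹ * π)                          ≈⟨ top ⟩
      β (V * q) (suc d) (suc d) * Ψ (suc d)                           ≈⟨ +-identityˡ _ ⟨
      0# + β (V * q) (suc d) (suc d) * Ψ (suc d)                      ≈⟨ +-congʳ (Σ<-zero (suc d) (λ n≤d → trans (*-congʳ (β-top n≤d)) (zeroˡ _))) ⟨
      Σ< (suc (suc d)) (λ n → β (V * q) (suc d) n * Ψ n)              ∎
      where
      π g : Carrier
      π = Π< (suc d) (λ k → (η − (τ * (q ^ suc k))) * (η − ((τ ⁻¹) * (q ^ℤ -[1+ k ]))))
      g = β (V * q) (suc d) (suc d) * Ψ (suc d)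
      top : (τ * q) ^ suc d * ((η ^ suc d) ⁻¹ * π) ≈ g
      top = linear-combination
        (((η ^ suc d) ⁻¹) ⊙ top-product (suc d) ⊕ g ⊙ ⁻¹-inverse (η ^ suc d) (^-nonzero (suc d) η≉0))
        (solve 5 (λ y e⁻¹ e π g → y :* (e⁻¹ :* π) :+ (e⁻¹ :* (e :* g) :+ g :* :1) := g :+ (e⁻¹ :* (y :* π) :+ g :* (e :* e⁻¹)))
          refl ((τ * q) ^ suc d) ((η ^ suc d) ⁻¹) (η ^ suc d) π g)

    h⊥-sum : ∀ {i} → i < D → (τ * q) ^ i * h⊥ (+ i) ≈ Σ< N (λ n → β (V * q) i n * Ψ n)
    h⊥-sum {i} (s≤s i≤1+d) = trans (h⊥-short-sum i≤1+d)
      (sym (Σ<-extend (s≤s (ℕₚ.m≤n⇒m≤1+n i≤1+d)) (λ i<k → trans (*-congʳ (β-upper (V * q) i<k)) (zeroˡ _))))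

    -- Distributes the units: `x (η - τ) = 1 - τx` and `τ (η - τ⁻¹ W) = τη - W`.
    τp⊥ : τ * p⊥ ≈ (τ * η − W) * (1# − τ * x)
    τp⊥ = linear-combination
      ((- ((η * x − τ * x) * W)) ⊙ ⁻¹-inverse τ τ≉0 ⊕ (τ * η − W) ⊙ ηx≈1)
      (solve 5 (λ τ η x W σ →
        τ :* (x :* ((η :- τ) :* (η :- σ :* W)))
        :+ (:- ((η :* x :- τ :* x) :* W) :* :1 :+ (τ :* η :- W) :* :1)
        := (τ :* η :- W) :* (:1 :- τ :* x)
        :+ (:- ((η :* x :- τ :* x) :* W) :* (τ :* σ) :+ (τ :* η :- W) :* (η :* x)))
       refl τ η x W (τ ⁻¹))

    ph⊥-S : ∀ {i} → i < D → (τ * q) ^ suc i * (p⊥ * h⊥ (+ i))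
          ≈ S N (suc i) − τ * x * ((1# − V * q ^ i) * S N i)
    ph⊥-S {i} i<D = linear-combination
      (Ψ-sum (s≤s i<D)
        ⊕ (q * σ) ⊙ τp⊥
        ⊕ (τ * p⊥ * q) ⊙ h⊥-sum i<D)
      (solve 9 (λ τ q y p h m a b σ →
        (τ :* q :* y) :* (p :* h) :+ (m :+ q :* σ :* (a :* b) :+ τ :* p :* q :* σ)
        := m :+ (q :* (a :* (b :* σ)) :+ q :* σ :* (τ :* p) :+ τ :* p :* q :* (y :* h)))
        refl τ q ((τ * q) ^ i) p⊥ (h⊥ (+ i)) (S N (suc i) − τ * x * ((1# − V * q ^ i) * S N i))
        (τ * η − W) (1# − τ * x) σ)
      where σ = Σ< N (λ n → β (V * q) i n * Ψ n)

    hh-S : ∀ {i} → i ≤ D → (τ * q) ^ i * hh i ≈ S N i − τ * x * ((1# − q ^ i) * S⁻ N i)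
    hh-S {i} i≤D = linear-combination
      (Φ-sum (s≤s i≤D) ⊕ (q ^ i) ⊙ hh-sum i≤D ⊕ (hh i) ⊙ *-^ τ q i)
      (solve 6 (λ y t I h r s → y :* h :+ (r :+ I :* s :+ h :* (t :* I)) := r :+ (I :* s :+ I :* (t :* h) :+ h :* y))
        refl ((τ * q) ^ i) (τ ^ i) (q ^ i) (hh i) (S N i − τ * x * ((1# − q ^ i) * S⁻ N i))
        (Σ< N (λ n → β W i n * Φ n)))

    1−W≉0 : ¬ (1# − W ≈ 0#)
    1−W≉0 = −-nonzero (λ 1≈W → q-injective {0} {D} (s≤s z≤n)
      (linear-combination ((- (q ^ D)) ⊙ 1≈W ⊕ (- 1#) ⊙ Wq^D≈1)
        (solve 2 (λ W A → :1 :+ (:- A :* W :+ :- :1 :* :1) := A :+ (:- A :* :1 :+ :- :1 :* (W :* A))) refl W (q ^ D))))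

    -- The polynomials `ℓ⁺` and `ℓ⁻` in terms of `S` and `T`.

    ℓ⁺-last : ℓ⁺ (+ D) ≡ - ((x * p⊥ * h⊥ (+ suc d)) / (τ ^ (D ℕ.+ 1) * poch q D))
    ℓ⁺-last = if-yes (D ℕ.≟ D) ≡.refl

    ℓ⁺-below : ∀ {i} → i < D → ℓ⁺ (+ i) ≡ (hh (suc i) − p⊥ * h⊥ (+ i)) / (τ ^ suc i * (1# − q ^ D) * poch q i)
    ℓ⁺-below {i} i<D = if-no (i ℕ.≟ D) (ℕₚ.<⇒≢ i<D)

    ℓ⁻-last : ℓ⁻ (+ D) ≡ (p⊥ * h⊥ (+ suc d)) / (τ ^ D * poch q D)
    ℓ⁻-last = if-yes (D ℕ.≟ D) ≡.refl

    ℓ⁻-below : ∀ {i} → i < D → ℓ⁻ (+ i) ≡ (q ^ D − q ^ i) / (τ ^ i * (q ^ D − 1#) * poch q i)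
      * (hh i − (1# − q ^ i) / (q ^ D − q ^ i) * (p⊥ * h⊥ (+ i ℤ.- + 1)))
    ℓ⁻-below {i} i<D = if-no (i ℕ.≟ D) (ℕₚ.<⇒≢ i<D)

    κ : ℕ → Carrier
    κ i = q ^ D * (τ * (τ ^ i * τ ^ i)) * poch q i

    κ≉0 : ∀ i → ¬ (κ i ≈ 0#)
    κ≉0 i = *-nonzero (*-nonzero (q^≉0 D) (*-nonzero τ≉0 (*-nonzero (^-nonzero i τ≉0) (^-nonzero i τ≉0)))) (poch-q-nonzero i)

    -- In `h (i + 1) - p⊥ h⊥ i` the terms `S (i + 1)` cancel and `τ x qⁱ⁺¹ (1 - W) S i` is left, up
    -- to the power of `τq`. Dividing by `1 - qᴰ = - qᴰ (1 - W)` produces the sign and the factor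
    -- `qᴰ` of `κ`.
    ℓ⁺-S-below : ∀ {i} → i < D → κ i * ℓ⁺ (+ i) ≈ - (x * S N i)
    ℓ⁺-S-below {i} i<D = *-cancelˡ-nonzero (*-nonzero (*-nonzero τq≉0 (q^≉0 i)) 1−W≉0) (linear-combination
      ((- (τ * q * y)) ⊙ quotient
        ⊕ (- 1#) ⊙ hh-S {suc i} i<D
        ⊕ ph⊥-S i<D
        ⊕ (τ * τ * q * t * (1# − A) * w * l) ⊙ *-^ τ q i
        ⊕ (- (τ * τ * q * (t * t) * I * w * l)) ⊙ Wq^D≈1)
      (solve 15 (λ q τ x W A I t w y l h₁ p h⊥ s₁ s →
        (τ :* q :* I :* (:1 :- W)) :* (A :* (τ :* (t :* t)) :* w :* l)
        :+ (:- (τ :* q :* y) :* (h₁ :- p :* h⊥)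
            :+ :- :1 :* (s₁ :- τ :* x :* ((:1 :- q :* I) :* s))
            :+ (s₁ :- τ :* x :* ((:1 :- W :* q :* I) :* s))
            :+ τ :* τ :* q :* t :* (:1 :- A) :* w :* l :* (t :* I)
            :+ :- (τ :* τ :* q :* (t :* t) :* I :* w :* l) :* :1)
        := (τ :* q :* I :* (:1 :- W)) :* (:- (x :* s))
        :+ (:- (τ :* q :* y) :* (τ :* t :* (:1 :- A) :* w :* l)
            :+ :- :1 :* ((τ :* q :* y) :* h₁)
            :+ (τ :* q :* y) :* (p :* h⊥)
            :+ τ :* τ :* q :* t :* (:1 :- A) :* w :* l :* y
            :+ :- (τ :* τ :* q :* (t :* t) :* I :* w :* l) :* (W :* A)))
       refl q τ x W A I t w y l (hh (suc i)) p⊥ (h⊥ (+ i)) (S N (suc i)) (S N i)))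
      where
      A I t w y l B : Carrier
      A = q ^ D
      I = q ^ i
      t = τ ^ i
      w = poch q i
      y = (τ * q) ^ i
      l = ℓ⁺ (+ i)
      B = τ ^ suc i * (1# − q ^ D) * poch q i
      quotient : B * l ≈ hh (suc i) − p⊥ * h⊥ (+ i)
      quotient = trans (reflexive (≡.cong (B *_) (ℓ⁺-below i<D)))
        (*-/-cancel _ (*-nonzero (*-nonzero (^-nonzero (suc i) τ≉0) (−-nonzero (q-injective {0} {D} (s≤s z≤n)))) (poch-q-nonzero i)))

    -- At index `D - 1` the second term of `ph⊥-S` carries `1 - V qᴰ⁻¹ = 1 - W qᴰ = 0`. Only `S D`
    -- survives, so the boundary definition fits the general formula.
    ℓ⁺-S-last : κ D * ℓ⁺ (+ D) ≈ - (x * S N D)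
    ℓ⁺-S-last = trans (reflexive (≡.cong (κ D *_) ℓ⁺-last)) (linear-combination
      ((A * t * w * Z) ⊙ ^-+ τ D 1
        ⊕ (- (A * t)) ⊙ *-/-cancel (x * p⊥ * h⊥ (+ suc d)) B≉0
        ⊕ (x * p⊥ * h⊥ (+ suc d)) ⊙ *-^ τ q D
        ⊕ (- x) ⊙ ph⊥-S (ℕₚ.n<1+n (suc d))
        ⊕ (- (x * (τ * x) * S N (suc d))) ⊙ Wq^D≈1)
      (solve 15 (λ q τ x W A I t w y p h s₁ s C Z →
        A :* (τ :* (t :* t)) :* w :* (:- Z)
        :+ (A :* t :* w :* Z :* (t :* (τ :* :1))
            :+ :- (A :* t) :* (x :* p :* h)
            :+ x :* p :* h :* (t :* A)
            :+ :- x :* (s₁ :- τ :* x :* ((:1 :- W :* q :* I) :* s))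
            :+ :- (x :* (τ :* x) :* s) :* :1)
        := :- (x :* s₁)
        :+ (A :* t :* w :* Z :* C
            :+ :- (A :* t) :* (C :* w :* Z)
            :+ x :* p :* h :* y
            :+ :- x :* (y :* (p :* h))
            :+ :- (x :* (τ :* x) :* s) :* (W :* (q :* I))))
       refl q τ x W A (q ^ suc d) t w ((τ * q) ^ D) p⊥ (h⊥ (+ suc d)) (S N D) (S N (suc d)) (τ ^ (D ℕ.+ 1)) Z))
      where
      A t w Z : Carrier
      A = q ^ D
      t = τ ^ D
      w = poch q D
      Z = (x * p⊥ * h⊥ (+ suc d)) / (τ ^ (D ℕ.+ 1) * poch q D)
      B≉0 : ¬ (τ ^ (D ℕ.+ 1) * poch q D ≈ 0#)
      B≉0 = *-nonzero (^-nonzero (D ℕ.+ 1) τ≉0) (poch-q-nonzero D)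

    ℓ⁺-S : ∀ {i} → i ≤ D → κ i * ℓ⁺ (+ i) ≈ - (x * S N i)
    ℓ⁺-S i≤D with ℕₚ.m≤n⇒m<n∨m≡n i≤D
    ... | inj₁ i<D    = ℓ⁺-S-below i<D
    ... | inj₂ ≡.refl = ℓ⁺-S-last

    -- The factor `1 - qⁱ`, supplied by the definition of `ℓ⁻`, extends `ph⊥-S` to `i = 0`: there
    -- `h⊥` at index `-1` is zero while `S 0` is one.
    ph⊥-S⁻ : ∀ {i} → i ≤ D → (τ * q) ^ i * ((1# − q ^ i) * (p⊥ * h⊥ (+ i ℤ.- + 1)))
           ≈ (1# − q ^ i) * (S N i − τ * x * ((1# − W * q ^ i) * S⁻ N i))
    ph⊥-S⁻ {zero} _ = solve 2 (λ a b → :1 :* ((:1 :- :1) :* a) := (:1 :- :1) :* b) refl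
      (p⊥ * h⊥ -[1+ 0 ]) (S N 0 − τ * x * ((1# − W * 1#) * 0#))
    ph⊥-S⁻ {suc i} i<D = linear-combination ((1# − q * q ^ i) ⊙ ph⊥-S i<D)
      (solve 9 (λ q r W I a y s₁ s u →
        y :* (a :* u) :+ a :* (s₁ :- r :* ((:1 :- W :* q :* I) :* s))
        := a :* (s₁ :- r :* ((:1 :- W :* (q :* I)) :* s)) :+ a :* (y :* u))
       refl q (τ * x) W (q ^ i) (1# − q * q ^ i) ((τ * q) ^ suc i) (S N (suc i)) (S N i) (p⊥ * h⊥ (+ i)))

    -- After clearing `qᴰ - qⁱ`, the coefficient of `S i` is `(A - I) - (1 - I) = A - 1`. That of
    -- `S (i - 1)` contains `(A - I) - (1 - W I) = (A - 1)(1 - W I)`, by `W A = 1`, so `A - 1` can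
    -- be cancelled and `T i` appears.
    ℓ⁻-S-below : ∀ {i} → i < D → τ ^ i * τ ^ i * q ^ i * poch q i * ℓ⁻ (+ i) ≈ S N i − τ * x * T N i
    ℓ⁻-S-below {i} i<D = trans (reflexive (≡.cong (τ ^ i * τ ^ i * q ^ i * poch q i *_) (ℓ⁻-below i<D)))
      (*-cancelˡ-nonzero A−1≉0 (linear-combination
      ((t * I * (A − I) * (h′ − k * P)) ⊙ ⁻¹-inverse B B≉0
        ⊕ (- (t * I * P)) ⊙ *-/-cancel (1# − I) A−I≉0
        ⊕ (- ((A − I) * h′ − (1# − I) * P)) ⊙ *-^ τ q i
        ⊕ (A − I) ⊙ hh-S (ℕₚ.<⇒≤ i<D)
        ⊕ (- 1#) ⊙ ph⊥-S⁻ (ℕₚ.<⇒≤ i<D)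
        ⊕ ((A − 1#) * (τ * x)) ⊙ T-S⁻ i N
        ⊕ (- (τ * x * (1# − I) * s′ * I)) ⊙ Wq^D≈1)
      (solve 14 (λ r W A I t w y h P B⁻¹ k s s′ T →
        (A :- :1) :* (t :* t :* I :* w :* ((A :- I) :* B⁻¹ :* (h :- k :* P)))
        :+ (t :* I :* (A :- I) :* (h :- k :* P) :* :1
            :+ :- (t :* I :* P) :* (:1 :- I)
            :+ :- ((A :- I) :* h :- (:1 :- I) :* P) :* (t :* I)
            :+ (A :- I) :* (s :- r :* ((:1 :- I) :* s′))
            :+ :- :1 :* ((:1 :- I) :* (s :- r :* ((:1 :- W :* I) :* s′)))
            :+ (A :- :1) :* r :* ((:1 :- W :* I) :* ((:1 :- I) :* s′))
            :+ :- (r :* (:1 :- I) :* s′ :* I) :* :1)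
        := (A :- :1) :* (s :- r :* T)
        :+ (t :* I :* (A :- I) :* (h :- k :* P) :* (t :* (A :- :1) :* w :* B⁻¹)
            :+ :- (t :* I :* P) :* ((A :- I) :* k)
            :+ :- ((A :- I) :* h :- (:1 :- I) :* P) :* y
            :+ (A :- I) :* (y :* h)
            :+ :- :1 :* (y :* ((:1 :- I) :* P))
            :+ (A :- :1) :* r :* T
            :+ :- (r :* (:1 :- I) :* s′ :* I) :* (W :* A)))
       refl (τ * x) W A I t (poch q i) ((τ * q) ^ i) h′ P (B ⁻¹) k (S N i) s′ (T N i))))
      where
      A I t B h′ P k s′ : Carrier
      A = q ^ D
      I = q ^ i
      t = τ ^ i
      B = t * (A − 1#) * poch q i
      h′ = hh i
      P = p⊥ * h⊥ (+ i ℤ.- + 1)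
      k = (1# − I) / (A − I)
      s′ = S⁻ N i
      A−1≉0 : ¬ (A − 1# ≈ 0#)
      A−1≉0 = −-nonzero (λ A≈1 → q-injective {0} {D} (s≤s z≤n) (sym A≈1))
      A−I≉0 : ¬ (A − I ≈ 0#)
      A−I≉0 = −-nonzero (λ A≈I → q-injective i<D (sym A≈I))
      B≉0 : ¬ (B ≈ 0#)
      B≉0 = *-nonzero (*-nonzero (^-nonzero i τ≉0) A−1≉0) (poch-q-nonzero i)

    -- Both `T D` and the second term of `ph⊥-S` vanish with `1 - W qᴰ`.
    ℓ⁻-S-last : τ ^ D * τ ^ D * q ^ D * poch q D * ℓ⁻ (+ D) ≈ S N D − τ * x * T N D
    ℓ⁻-S-last = trans (reflexive (≡.cong (τ ^ D * τ ^ D * q ^ D * poch q D *_) ℓ⁻-last)) (linear-combination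
      ((t * A) ⊙ *-/-cancel P (*-nonzero (^-nonzero D τ≉0) (poch-q-nonzero D))
        ⊕ (- P) ⊙ *-^ τ q D
        ⊕ ph⊥-S (ℕₚ.n<1+n (suc d))
        ⊕ (τ * x) ⊙ T-S⁻ D N
        ⊕ (τ * x * (q * I) * S N (suc d)) ⊙ Wq^D≈1)
      (solve 13 (λ q r W A I t w y P Z s₁ s T →
        t :* t :* A :* w :* Z
        :+ (t :* A :* P
            :+ :- P :* (t :* A)
            :+ (s₁ :- r :* ((:1 :- W :* q :* I) :* s))
            :+ r :* ((:1 :- W :* (q :* I)) :* ((:1 :- q :* I) :* s))
            :+ r :* (q :* I) :* s :* :1)
        := (s₁ :- r :* T)
        :+ (t :* A :* (t :* w :* Z)
            :+ :- P :* y
            :+ y :* P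
            :+ r :* T
            :+ r :* (q :* I) :* s :* (W :* (q :* I))))
       refl q (τ * x) W A I t (poch q D) ((τ * q) ^ D) P (P / (τ ^ D * poch q D)) (S N D) (S N (suc d)) (T N D)))
      where
      A I t P : Carrier
      A = q ^ D
      I = q ^ suc d
      t = τ ^ D
      P = p⊥ * h⊥ (+ suc d)

    ℓ⁻-S : ∀ {i} → i ≤ D → τ ^ i * τ ^ i * q ^ i * poch q i * ℓ⁻ (+ i) ≈ S N i − τ * x * T N i
    ℓ⁻-S i≤D with ℕₚ.m≤n⇒m<n∨m≡n i≤D
    ... | inj₁ i<D    = ℓ⁻-S-below i<D
    ... | inj₂ ≡.refl = ℓ⁻-S-last

    -- Uses the multiplier of index `i`, so that it combines with `ℓ⁺-S`. The quotient of
    -- consecutive values of `κ` is `τ² (1 - qⁱ)`, whose zero at `i = 0` matches the convention at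
    -- index `-1`.
    ℓ⁺-previous : ∀ {i} → i ≤ D → κ i * ℓ⁺ (+ i ℤ.- + 1) ≈ - (τ * τ * ((1# − q ^ i) * (x * S⁻ N i)))
    ℓ⁺-previous {zero} _ = solve 3 (λ k r x → k :* :0 := :- (r :* ((:1 :- :1) :* (x :* :0)))) refl (κ 0) (τ * τ) x
    ℓ⁺-previous {suc i} i<D = linear-combination ((τ * τ * (1# − q * q ^ i)) ⊙ ℓ⁺-S (ℕₚ.<⇒≤ i<D))
      (solve 9 (λ q τ x A I t w l s →
        A :* (τ :* (τ :* t :* (τ :* t))) :* (w :* (:1 :- q :* I)) :* l
        :+ τ :* τ :* (:1 :- q :* I) :* (:- (x :* s))
        := :- (τ :* τ :* ((:1 :- q :* I) :* (x :* s)))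
        :+ τ :* τ :* (:1 :- q :* I) :* (A :* (τ :* (t :* t)) :* w :* l))
       refl q τ x (q ^ D) (q ^ i) (τ ^ i) (poch q i) (ℓ⁺ (+ i)) (S N i))

    -- The four relations.

    σ c₀ : Carrier
    σ = τ ⁻¹
    c₀ = τ * q ^ D + σ

    τσ≈1 : τ * σ ≈ 1#
    τσ≈1 = ⁻¹-inverse τ τ≉0

    power-ratio : ∀ {z a} → z * q ^ D ≈ a → z ≈ W * a
    power-ratio {z} {a} zq^D≈a = linear-combination ((- z) ⊙ Wq^D≈1 ⊕ W ⊙ zq^D≈a)
      (solve 4 (λ z a W A → z :+ (:- z :* :1 :+ W :* a) := W :* a :+ (:- z :* (W :* A) :+ W :* (z :* A)))
        refl z a W (q ^ D))

    -- `η` removes `x` from `- x S i`. Writing `S i` as `(S i - τ x T i) + τ x T i` gives `ℓ⁻ i`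
    -- and, through `T-S⁻`, the previous `ℓ⁺`. `z` is `qⁱ⁻ᴰ`, known only by its product with `qᴰ`,
    -- which keeps integer exponents out of the algebra. The case `i = D` is included for use in
    -- `η-ℓ⁻`.
    η-ℓ⁺ : ∀ {i z} → i ≤ D → z * q ^ D ≈ q ^ i →
      η * ℓ⁺ (+ i) ≈ (σ * (1# − z)) * ℓ⁺ (+ i ℤ.- + 1) − (σ * z) * ℓ⁻ (+ i)
    η-ℓ⁺ {i} {z} i≤D zq^D≈q^i = *-cancelˡ-nonzero (*-nonzero (κ≉0 i) τ≉0) (linear-combination
      ((τ * η) ⊙ ℓ⁺-S i≤D
        ⊕ (- (τ * s)) ⊙ ηx≈1
        ⊕ (- (τ * σ * (1# − z))) ⊙ ℓ⁺-previous i≤D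
        ⊕ (τ * σ * τ * (t * t) * w * l) ⊙ zq^D≈q^i
        ⊕ (τ * σ * τ) ⊙ ℓ⁻-S i≤D
        ⊕ (- (τ * σ * τ * τ * x)) ⊙ T-S⁻ i N
        ⊕ (- (τ * σ * τ * τ * (1# − I) * x * s′)) ⊙ power-ratio zq^D≈q^i
        ⊕ (τ * s) ⊙ τσ≈1)
      (solve 16 (λ τ σ η x W A I t w z a m l s s′ T →
        (A :* (τ :* (t :* t)) :* w :* τ) :* (η :* a)
        :+ (τ :* η :* (:- (x :* s))
            :+ :- (τ :* s) :* :1
            :+ :- (τ :* σ :* (:1 :- z)) :* (:- (τ :* τ :* ((:1 :- I) :* (x :* s′))))
            :+ τ :* σ :* τ :* (t :* t) :* w :* l :* I
            :+ τ :* σ :* τ :* (s :- τ :* x :* T)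
            :+ :- (τ :* σ :* τ :* τ :* x) :* ((:1 :- W :* I) :* ((:1 :- I) :* s′))
            :+ :- (τ :* σ :* τ :* τ :* (:1 :- I) :* x :* s′) :* (W :* I)
            :+ τ :* s :* :1)
        := (A :* (τ :* (t :* t)) :* w :* τ) :* ((σ :* (:1 :- z)) :* m :- (σ :* z) :* l)
        :+ (τ :* η :* (A :* (τ :* (t :* t)) :* w :* a)
            :+ :- (τ :* s) :* (η :* x)
            :+ :- (τ :* σ :* (:1 :- z)) :* (A :* (τ :* (t :* t)) :* w :* m)
            :+ τ :* σ :* τ :* (t :* t) :* w :* l :* (z :* A)
            :+ τ :* σ :* τ :* (t :* t :* I :* w :* l)
            :+ :- (τ :* σ :* τ :* τ :* x) :* T
            :+ :- (τ :* σ :* τ :* τ :* (:1 :- I) :* x :* s′) :* z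
            :+ τ :* s :* (τ :* σ)))
       refl τ σ η x W (q ^ D) I t w z (ℓ⁺ (+ i)) (ℓ⁺ (+ i ℤ.- + 1)) l s s′ (T N i)))
      where
      I t w l s s′ : Carrier
      I = q ^ i
      t = τ ^ i
      w = poch q i
      l = ℓ⁻ (+ i)
      s = S N i
      s′ = S⁻ N i

    -- `S-recurrence` times `x`, solved for `τ x² S i`. By `ηx = 1`, the terms `q τ S i` and
    -- `q τ² x T i` combine to `ℓ⁻ i`; the constant `c₀` arises as `τ² qⁱ⁺¹ + W qⁱ⁺¹ = τ c₀ z`.
    x-ℓ⁺ : ∀ {i z} → i < D → z * q ^ D ≈ q ^ suc i →
      x * ℓ⁺ (+ i) ≈ (σ * z) * ℓ⁻ (+ i) + (c₀ * z) * ℓ⁺ (+ i) + (τ * (1# − q ^ suc i)) * ℓ⁺ (+ suc i)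
    x-ℓ⁺ {i} {z} i<D zq^D≈q^1+i = *-cancelˡ-nonzero (*-nonzero (κ≉0 i) τ≉0) (linear-combination
      ((τ * x − (τ * τ * A + τ * σ) * z) ⊙ ℓ⁺-S (ℕₚ.<⇒≤ i<D)
        ⊕ (τ * τ * x * s − τ * σ * τ * (t * t) * w * l) ⊙ zq^D≈q^1+i
        ⊕ (- (τ * σ * τ * q)) ⊙ ℓ⁻-S (ℕₚ.<⇒≤ i<D)
        ⊕ (- 1#) ⊙ ℓ⁺-S {suc i} i<D
        ⊕ x ⊙ S-recurrence (s≤s i<D)
        ⊕ (τ * σ * x * s) ⊙ power-ratio zq^D≈q^1+i
        ⊕ (q * τ * s) ⊙ ηx≈1
        ⊕ (W * q * I * x * s − τ * q * s + τ * τ * q * x * T N i) ⊙ τσ≈1)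
      (solve 17 (λ q τ σ η x W A I t w z a l b s s₁ T →
        (A :* (τ :* (t :* t)) :* w :* τ) :* (x :* a)
        :+ ((τ :* x :- (τ :* τ :* A :+ τ :* σ) :* z) :* (:- (x :* s))
            :+ (τ :* τ :* x :* s :- τ :* σ :* τ :* (t :* t) :* w :* l) :* (q :* I)
            :+ :- (τ :* σ :* τ :* q) :* (s :- τ :* x :* T)
            :+ :- :1 :* (:- (x :* s₁))
            :+ x :* ((τ :* x :+ q :* τ :* η :- τ :* τ :* q :* I :- W :* q :* I) :* s :- q :* τ :* τ :* T)
            :+ τ :* σ :* x :* s :* (W :* (q :* I))
            :+ q :* τ :* s :* :1
            :+ (W :* q :* I :* x :* s :- τ :* q :* s :+ τ :* τ :* q :* x :* T) :* :1)
        := (A :* (τ :* (t :* t)) :* w :* τ)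
             :* ((σ :* z) :* l :+ ((τ :* A :+ σ) :* z) :* a :+ (τ :* (:1 :- q :* I)) :* b)
        :+ ((τ :* x :- (τ :* τ :* A :+ τ :* σ) :* z) :* (A :* (τ :* (t :* t)) :* w :* a)
            :+ (τ :* τ :* x :* s :- τ :* σ :* τ :* (t :* t) :* w :* l) :* (z :* A)
            :+ :- (τ :* σ :* τ :* q) :* (t :* t :* I :* w :* l)
            :+ :- :1 :* (A :* (τ :* (τ :* t :* (τ :* t))) :* (w :* (:1 :- q :* I)) :* b)
            :+ x :* s₁
            :+ τ :* σ :* x :* s :* z
            :+ q :* τ :* s :* (η :* x)
            :+ (W :* q :* I :* x :* s :- τ :* q :* s :+ τ :* τ :* q :* x :* T) :* (τ :* σ)))
       refl q τ σ η x W A I t w z (ℓ⁺ (+ i)) l (ℓ⁺ (+ suc i)) s (S N (suc i)) (T N i)))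
      where
      A I t w l s : Carrier
      A = q ^ D
      I = q ^ i
      t = τ ^ i
      w = poch q i
      l = ℓ⁻ (+ i)
      s = S N i

    x-ℓ⁺-previous : ∀ {i z} → i ≤ D → z * q ^ D ≈ q ^ i →
      x * ℓ⁺ (+ i ℤ.- + 1) ≈ (σ * z) * ℓ⁻ (+ i ℤ.- + 1) + (c₀ * z) * ℓ⁺ (+ i ℤ.- + 1) + (τ * (1# − q ^ i)) * ℓ⁺ (+ i)
    x-ℓ⁺-previous {suc i} i<D zq^D≈q^i = x-ℓ⁺ i<D zq^D≈q^i
    x-ℓ⁺-previous {zero} {z} _ _ = solve 5 (λ x a b c l → x :* :0 := a :* :0 :+ b :* :0 :+ (c :* (:1 :- :1)) :* l)
      refl x (σ * z) (c₀ * z) τ (ℓ⁺ (+ 0))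

    ratio-nonzero : ∀ {z} n → z * q ^ D ≈ q ^ n → ¬ (z ≈ 0#)
    ratio-nonzero n zq^D≈q^n z≈0 = q^≉0 n (trans (sym zq^D≈q^n) (trans (*-congʳ z≈0) (zeroˡ _)))

    -- `η-ℓ⁺` is multiplied by `x`, and `x-ℓ⁺` at `i - 1` is substituted. The coefficient of
    -- `τ ℓ⁺ i` becomes `(1 - z)(1 - qⁱ) - 1 = - z (qᴰ - qⁱ + 1)`, so `z` cancels throughout.
    x-ℓ⁻ : ∀ {i z} → i ≤ D → z * q ^ D ≈ q ^ i →
      x * ℓ⁻ (+ i) ≈ (σ * (1# − z)) * ℓ⁻ (+ i ℤ.- + 1) + (c₀ * (1# − z)) * ℓ⁺ (+ i ℤ.- + 1)
                     − (τ * ((q ^ D − q ^ i) + 1#)) * ℓ⁺ (+ i)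
    x-ℓ⁻ {i} {z} i≤D zq^D≈q^i = *-cancelˡ-nonzero (ratio-nonzero i zq^D≈q^i) (linear-combination
      ((τ * x) ⊙ η-ℓ⁺ i≤D zq^D≈q^i
        ⊕ ((1# − z) * x * m⁺ − z * x * l) ⊙ τσ≈1
        ⊕ (1# − z) ⊙ x-ℓ⁺-previous i≤D zq^D≈q^i
        ⊕ (- (τ * a)) ⊙ ηx≈1
        ⊕ (τ * a) ⊙ zq^D≈q^i)
      (solve 12 (λ τ σ η x A I z c a l m⁺ m⁻ →
        z :* (x :* l)
        :+ (τ :* x :* ((σ :* (:1 :- z)) :* m⁺ :- (σ :* z) :* l)
            :+ ((:1 :- z) :* x :* m⁺ :- z :* x :* l) :* :1
            :+ (:1 :- z) :* ((σ :* z) :* m⁻ :+ (c :* z) :* m⁺ :+ (τ :* (:1 :- I)) :* a)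
            :+ :- (τ :* a) :* :1
            :+ τ :* a :* I)
        := z :* ((σ :* (:1 :- z)) :* m⁻ :+ (c :* (:1 :- z)) :* m⁺ :- (τ :* ((A :- I) :+ :1)) :* a)
        :+ (τ :* x :* (η :* a)
            :+ ((:1 :- z) :* x :* m⁺ :- z :* x :* l) :* (τ :* σ)
            :+ (:1 :- z) :* (x :* m⁺)
            :+ :- (τ :* a) :* (η :* x)
            :+ τ :* a :* (z :* A)))
       refl τ σ η x (q ^ D) (q ^ i) z c₀ a l m⁺ (ℓ⁻ (+ i ℤ.- + 1))))
      where
      a l m⁺ : Carrier
      a = ℓ⁺ (+ i)
      l = ℓ⁻ (+ i)
      m⁺ = ℓ⁺ (+ i ℤ.- + 1)

    -- `x-ℓ⁺` is multiplied by `η`, and `η-ℓ⁺` is substituted at `i` and `i + 1`. Here `1 - (1 -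
    -- qⁱ⁺¹)(1 - z′) = z′ (qᴰ - qⁱ⁺¹ + 1)`, and `z′` cancels.
    η-ℓ⁻ : ∀ {i z z′} → i < D → z * q ^ D ≈ q ^ i → z′ * q ^ D ≈ q ^ suc i →
      η * ℓ⁻ (+ i) ≈ (((c₀ * (z − 1#)) * ℓ⁺ (+ i ℤ.- + 1) + (c₀ * z) * ℓ⁻ (+ i))
                       + (τ * ((q ^ D − q ^ suc i) + 1#)) * ℓ⁺ (+ i))
                     + (τ * (1# − q ^ suc i)) * ℓ⁻ (+ suc i)
    η-ℓ⁻ {i} {z} {z′} i<D zq^D≈q^i z′q^D≈q^1+i = *-cancelˡ-nonzero (ratio-nonzero (suc i) z′q^D≈q^1+i) (linear-combination
      ((- (τ * η)) ⊙ x-ℓ⁺ i<D z′q^D≈q^1+i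
        ⊕ (- (τ * c₀ * z′)) ⊙ η-ℓ⁺ (ℕₚ.<⇒≤ i<D) zq^D≈q^i
        ⊕ (- (τ * τ * (1# − q * I))) ⊙ η-ℓ⁺ {suc i} i<D z′q^D≈q^1+i
        ⊕ (- (z′ * η * l) − c₀ * z′ * ((1# − z) * m − z * l) − τ * (1# − q * I) * ((1# − z′) * a − z′ * n⁻)) ⊙ τσ≈1
        ⊕ (τ * a) ⊙ ηx≈1
        ⊕ (- (τ * a)) ⊙ z′q^D≈q^1+i)
      (solve 15 (λ q τ σ η x A I z z′ c a l m n⁺ n⁻ →
        z′ :* (η :* l)
        :+ (:- (τ :* η) :* ((σ :* z′) :* l :+ (c :* z′) :* a :+ (τ :* (:1 :- q :* I)) :* n⁺)
            :+ :- (τ :* c :* z′) :* ((σ :* (:1 :- z)) :* m :- (σ :* z) :* l)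
            :+ :- (τ :* τ :* (:1 :- q :* I)) :* ((σ :* (:1 :- z′)) :* a :- (σ :* z′) :* n⁻)
            :+ (:- (z′ :* η :* l) :- c :* z′ :* ((:1 :- z) :* m :- z :* l)
                  :- τ :* (:1 :- q :* I) :* ((:1 :- z′) :* a :- z′ :* n⁻)) :* :1
            :+ τ :* a :* :1
            :+ :- (τ :* a) :* (q :* I))
        := z′ :* ((((c :* (z :- :1)) :* m :+ (c :* z) :* l) :+ (τ :* ((A :- q :* I) :+ :1)) :* a)
                  :+ (τ :* (:1 :- q :* I)) :* n⁻)
        :+ (:- (τ :* η) :* (x :* a)
            :+ :- (τ :* c :* z′) :* (η :* a)
            :+ :- (τ :* τ :* (:1 :- q :* I)) :* (η :* n⁺)
            :+ (:- (z′ :* η :* l) :- c :* z′ :* ((:1 :- z) :* m :- z :* l)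
                  :- τ :* (:1 :- q :* I) :* ((:1 :- z′) :* a :- z′ :* n⁻)) :* (τ :* σ)
            :+ τ :* a :* (η :* x)
            :+ :- (τ :* a) :* (z′ :* A)))
       refl q τ σ η x (q ^ D) I z z′ c₀ a l m (ℓ⁺ (+ suc i)) n⁻))
      where
      I a l m n⁻ : Carrier
      I = q ^ i
      a = ℓ⁺ (+ i)
      l = ℓ⁻ (+ i)
      m = ℓ⁺ (+ i ℤ.- + 1)
      n⁻ = ℓ⁻ (+ suc i)

    q^ℤ-ratio : ∀ {i} → i ≤ D → q ^ℤ (+ i ℤ.- + D) * q ^ D ≈ q ^ i
    q^ℤ-ratio {i} i≤D = begin
      q ^ℤ (+ i ℤ.- + D) * q ^ D                        ≡⟨ ≡.cong₂ (λ k m → q ^ℤ k * q ^ m) i−D≡ (≡.sym (ℕₚ.m∸n+n≡m i≤D)) ⟩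
      q ^ℤ (ℤ.- (+ (D ∸ i))) * q ^ (D ∸ i ℕ.+ i)        ≈⟨ *-congˡ (^-+ q (D ∸ i) i) ⟩
      q ^ℤ (ℤ.- (+ (D ∸ i))) * (q ^ (D ∸ i) * q ^ i)    ≈⟨ *-assoc _ _ _ ⟨
      (q ^ℤ (ℤ.- (+ (D ∸ i))) * q ^ (D ∸ i)) * q ^ i    ≈⟨ *-congʳ (q^ℤ-neg (D ∸ i)) ⟩
      1# * q ^ i                                        ≈⟨ *-identityˡ _ ⟩
      q ^ i                                             ∎
      where
      i−D≡ : + i ℤ.- + D ≡ ℤ.- (+ (D ∸ i))
      i−D≡ = ≡.trans (ℤₚ.[+m]-[+n]≡m⊖n i D) (ℤₚ.⊖-≤ i≤D)

    q^ℤ-next-ratio : ∀ {i} → i < D → q ^ℤ ((+ i ℤ.- + D) ℤ.+ + 1) * q ^ D ≈ q ^ suc i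
    q^ℤ-next-ratio {i} i<D = trans (reflexive (≡.cong (λ k → q ^ℤ k * q ^ D) shift)) (q^ℤ-ratio i<D)
      where
      shift : (+ i ℤ.- + D) ℤ.+ + 1 ≡ + suc i ℤ.- + D
      shift = ≡.trans (ℤₚ.+-comm (+ i ℤ.- + D) (+ 1)) (≡.sym (ℤₚ.+-assoc (+ 1) (+ i) (ℤ.- (+ D))))

theorem9p5 : ∀ {c ℓ} (K : Field c ℓ) → CharZero K →
  let open Field K
      open FieldOps K
  in (qn : ℕ) → IsPrimePower qn → (D : ℕ) → 3 ≤ D → (e : Param qn) →
  let open Objects K qn D
  in (τ η : Carrier) → (τ * τ) * qPow e ≈ - 1# → ¬ (η ≈ 0#) →
  let open Poly τ η
      c₀ = (τ * (q ^ D)) + (τ ⁻¹)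
  in (i : ℕ) → i < D →
     (η * ℓ⁻ (+ i) ≈
        (((c₀ * ((q ^ℤ (+ i ℤ.- + D)) − 1#)) * ℓ⁺ (+ i ℤ.- + 1)
         + (c₀ * (q ^ℤ (+ i ℤ.- + D))) * ℓ⁻ (+ i))
         + (τ * ((q ^ D − q ^ (ℕ.suc i)) + 1#)) * ℓ⁺ (+ i))
         + (τ * (1# − q ^ (ℕ.suc i))) * ℓ⁻ (+ ℕ.suc i))
   × ((η ⁻¹) * ℓ⁻ (+ i) ≈
        ((τ ⁻¹) * (1# − q ^ℤ (+ i ℤ.- + D))) * ℓ⁻ (+ i ℤ.- + 1)
        + (c₀ * (1# − q ^ℤ (+ i ℤ.- + D))) * ℓ⁺ (+ i ℤ.- + 1)
        − (τ * ((q ^ D − q ^ i) + 1#)) * ℓ⁺ (+ i))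
   × (η * ℓ⁺ (+ i) ≈
        ((τ ⁻¹) * (1# − q ^ℤ (+ i ℤ.- + D))) * ℓ⁺ (+ i ℤ.- + 1)
        − ((τ ⁻¹) * (q ^ℤ (+ i ℤ.- + D))) * ℓ⁻ (+ i))
   × ((η ⁻¹) * ℓ⁺ (+ i) ≈
        ((τ ⁻¹) * (q ^ℤ ((+ i ℤ.- + D) ℤ.+ + 1))) * ℓ⁻ (+ i)
        + (c₀ * (q ^ℤ ((+ i ℤ.- + D) ℤ.+ + 1))) * ℓ⁺ (+ i)
        + (τ * (1# − q ^ (ℕ.suc i))) * ℓ⁺ (+ ℕ.suc i))
theorem9p5 K charZero qn qn-primePower D@(suc (suc (suc d))) (s≤s (s≤s (s≤s z≤n))) e τ η τ²q^D+e≈-1 η≉0 i i<D =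
    η-ℓ⁻ i<D (q^ℤ-ratio i≤D) (q^ℤ-next-ratio i<D)
  , x-ℓ⁻ i≤D (q^ℤ-ratio i≤D)
  , η-ℓ⁺ i≤D (q^ℤ-ratio i≤D)
  , x-ℓ⁺ i<D (q^ℤ-next-ratio i<D)
  where
  open Field K
  open OverField K
  open IntegerSolver commutativeRing
  open Naturals charZero
  open Objects K qn D using (q; qPow)

  i≤D : i ≤ D
  i≤D = ℕₚ.<⇒≤ i<D

  1<qn : 1 < qn
  1<qn = primePower⇒1< qn-primePower

  q≉0 : ¬ (q ≈ 0#)
  q≉0 q≈0 = ι-injective (ℕₚ.<-trans (s≤s z≤n) 1<qn) (sym q≈0)

  τ≉0 : ¬ (τ ≈ 0#)
  τ≉0 τ≈0 = 0≉1 (linear-combination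
    ((τ * qPow e) ⊙ τ≈0 ⊕ (- 1#) ⊙ τ²q^D+e≈-1)
    (solve 2 (λ τ Q → :0 :+ (τ :* Q :* :0 :+ :- :1 :* :- :1) := :1 :+ (τ :* Q :* τ :+ :- :1 :* (τ :* τ :* Q))) refl τ (qPow e)))

  -- The module is indexed by `D - 2`, which is `suc d` for `D = 3 + d`.
  open Polynomials qn (suc d) q≉0 (ι-^-injective 1<qn) τ η τ≉0 η≉0
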